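{- Every connected planar graph $G$ with girth at least $6$ is a Gallai graph; that is, if $n$ denotes the number of non-isolated vertices of $G$, then $\mathrm{pn}(G)\le\lfloor n/2\rfloor$.
   Context: All graphs are finite and simple. A path decomposition of a graph $G$ is a set of pairwise edge-disjoint paths of $G$ that together cover $E(G)$; $\mathrm{pn}(G)$ is the minimum size of a path decomposition of $G$ (it is $0$ if $G$ has no edges). A graph $G$ with $n$ non-isolated vertices (vertices of positive degree) is called a Gallai graph if $\mathrm{pn}(G)\le\lfloor n/2\rfloor$. The girth of a graph is the length of its shortest cycle, taken to be infinite if there is no cycle. -}

module Defs where

open import Data.Bool using (Bool; true; false; T)
open import Data.Bool.Properties using (T?)
open import Data.Fin as Fin using (Fin; toℕ)
open import Data.Fin.Properties as Finₚ using ()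
open import Data.List using (List; []; _∷_; [_]; _++_; length; filter; map; allFin; lookup; cartesianProduct)
open import Data.List.Membership.Propositional using (_∈_; lose)
open import Data.List.Membership.Propositional.Properties using (∈-map⁺; ∈-filter⁺; ∈-cartesianProduct⁺; ∈-allFin; ∈-lookup)
open import Data.List.Relation.Unary.All as All using (All; []; _∷_)
open import Data.List.Relation.Unary.All.Properties as Allₚ using (all-filter)
open import Data.List.Relation.Unary.AllPairs as AllPairs using (AllPairs; []; _∷_)
open import Data.List.Relation.Unary.AllPairs.Properties as AllPairsₚ using ()
open import Data.List.Relation.Unary.Any as Any using (Any; here; there)
open import Data.List.Relation.Unary.Linked as Linked using (Linked; []; [-]; _∷_)
open import Data.List.Relation.Unary.Unique.Propositional using (Unique)
import Data.List.Relation.Unary.Unique.Propositional.Properties as Uniqueₚ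
open import Data.Nat using (ℕ; zero; suc; _+_; _*_; _≤_; _<_; z≤n; s≤s; ⌊_/2⌋; _≤?_; _<?_; _≟_)
open import Data.Nat.Properties using (≤-reflexive; <-asym; <-cmp)
open import Data.Product using (Σ; Σ-syntax; ∃; ∃-syntax; _×_; _,_; proj₁; proj₂)
open import Data.Product.Properties using (≡-dec)
open import Data.Sum using (_⊎_; inj₁; inj₂)
open import Data.Unit using (⊤; tt)
open import Function using (_∘_; _on_)
open import Function.Bundles using (_↔_; _↠_; _⇔_; Inverse; Surjection)
open import Relation.Binary using (Rel; Decidable; tri<; tri≈; tri>)
open import Relation.Binary.Construct.Closure.Equivalence using (EqClosure)
open import Relation.Binary.Construct.Closure.ReflexiveTransitive using (Star)
open import Relation.Binary.PropositionalEquality using (_≡_; _≢_; refl; sym; cong; subst)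
open import Relation.Nullary using (¬_; Dec; yes; no; contradiction)
open import Relation.Nullary.Decidable using (map′; ¬?; _×-dec_; _⊎-dec_; _→-dec_)
import Relation.Unary as U
open import Level using (0ℓ)

------------------------------------------------------------------------
-- Graphs

-- Adjacency is Boolean so that each edge has a unique adjacency proof; darts
-- (below) are then counted without multiplicity.
record Graph (n : ℕ) : Set where
  field
    adj        : Fin n → Fin n → Bool
    adj-sym    : ∀ u v → adj u v ≡ adj v u
    adj-irrefl : ∀ v → adj v v ≡ false

  Adj : Rel (Fin n) 0ℓ
  Adj u v = T (adj u v)

  Adj? : Decidable Adj
  Adj? u v = T? (adj u v)

  degree : Fin n → ℕ
  degree v = length (filter (Adj? v) (allFin n))

  nonIsolated : ℕ
  nonIsolated = length (filter (λ v → 0 <? degree v) (allFin n))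

  Connected : Set
  Connected = ∀ u v → Star Adj u v

------------------------------------------------------------------------
-- Cycles and girth

module _ {n : ℕ} (G : Graph n) where
  open Graph G

  record IsCycle (x : Fin n) (xs : List (Fin n)) : Set where
    field
      atLeast3 : 2 ≤ length xs
      distinct : Unique (x ∷ xs)
      closed   : Linked Adj (x ∷ xs ++ [ x ])

  -- Holds vacuously for forests, in keeping with girth ∞.
  GirthAtLeast : ℕ → Set
  GirthAtLeast k = ∀ x xs → IsCycle x xs → k ≤ length (x ∷ xs)

------------------------------------------------------------------------
-- Planarity

-- k is the number of equivalence classes of R: some f onto Fin k has the
-- classes of R as its fibres.
HasClasses : {A : Set} → Rel A 0ℓ → ℕ → Set
HasClasses {A} R k =
  Σ[ f ∈ A ↠ Fin k ] (∀ x y → (Surjection.to f x ≡ Surjection.to f y) ⇔ R x y)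

SameOrbit : {A : Set} → (A → A) → Rel A 0ℓ
SameOrbit f = EqClosure (λ x y → f x ≡ y)

module _ {n : ℕ} (G : Graph n) where
  open Graph G

  -- An edge together with one of its two orientations.
  record Dart : Set where
    constructor dart
    field
      src  : Fin n
      tgt  : Fin n
      edge : Adj src tgt

  open Dart

  rev : Dart → Dart
  rev (dart u v e) = dart v u (subst T (adj-sym u v) e)

  -- A rotation system: at every vertex, a cyclic order of the darts leaving it,
  -- i.e. a permutation of all darts whose orbits are the sets of darts with a
  -- common source.
  record RotationSystem : Set where
    field
      rotation   : Dart ↔ Dart

    next : Dart → Dart
    next = Inverse.to rotation

    field
      fixesSrc   : ∀ d → src (next d) ≡ src d
      transitive : ∀ d e → src d ≡ src e → SameOrbit next d e

    -- Its orbits are the boundary walks of the faces of the embedding.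
    face : Dart → Dart
    face d = next (rev d)

  -- A graph is planar when it has a cellular embedding in the sphere (one sphere
  -- per component having an edge; isolated vertices carry no darts and are
  -- irrelevant). A rotation system is a cellular embedding of each component in
  -- a closed orientable surface, and v - e + f = 2c - 2g, where g ≥ 0 is the sum
  -- of the genera of these c surfaces; so v + f ≡ e + 2 * c says that all of them
  -- are spheres.
  record Planar : Set where
    field
      embedding : RotationSystem
    open RotationSystem embedding public
    field
      v e f c    : ℕ
      vertices   : HasClasses (λ d d′ → src d ≡ src d′) v
      edges      : HasClasses (λ d d′ → d ≡ d′ ⊎ rev d ≡ d′) e
      faces      : HasClasses (SameOrbit face) f
      components : HasClasses (λ d d′ → Star Adj (src d) (src d′)) c
      euler      : v + f ≡ e + 2 * c

------------------------------------------------------------------------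
-- Path decompositions

module _ {n : ℕ} where

  -- The edges of a path given by its vertex sequence, oriented along it.
  steps : List (Fin n) → List (Fin n × Fin n)
  steps []           = []
  steps (x ∷ [])     = []
  steps (x ∷ y ∷ xs) = (x , y) ∷ steps (y ∷ xs)

  Traverses : List (Fin n) → Fin n → Fin n → Set
  Traverses p u v = (u , v) ∈ steps p ⊎ (v , u) ∈ steps p

  EdgeDisjoint : List (Fin n) → List (Fin n) → Set
  EdgeDisjoint p q = ∀ u v → Traverses p u v → ¬ Traverses q u v

module _ {n : ℕ} (G : Graph n) where
  open Graph G

  record IsPath (p : List (Fin n)) : Set where
    constructor isPath
    field
      nonempty : 1 ≤ length p
      distinct : Unique p
      linked   : Linked Adj p

  -- One-vertex paths are allowed; they have no effect on the minimum size.
  record IsPathDecomposition (ps : List (List (Fin n))) : Set where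
    constructor isPathDecomposition
    field
      paths    : All IsPath ps
      disjoint : AllPairs EdgeDisjoint ps
      covers   : ∀ u v → Adj u v → Any (λ p → Traverses p u v) ps

  -- The remainder of this module constructs the minimum pn; it is characterized
  -- by pn-attained and pn-minimal.

  HasDecompositionOfSize : ℕ → Set
  HasDecompositionOfSize k = ∃[ ps ] (length ps ≡ k × IsPathDecomposition ps)

  private
    Searchable : {A : Set} → (A → Set) → Set₁
    Searchable {A} B = {P : A → Set} → U.Decidable P → Dec (∃[ x ] (B x × P x))

    searchLists : {A : Set} {B : A → Set} → Searchable B → ∀ k →
                  Searchable (λ xs → length xs ≤ k × All B xs)
    searchLists s zero P? =
      map′ (λ p → [] , (z≤n , []) , p) (λ { ([] , _ , p) → p }) (P? [])
    searchLists s (suc k) P? =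
      map′ (λ { (inj₁ p) → [] , (z≤n , []) , p
              ; (inj₂ (x , b , xs , (l , bs) , p)) → x ∷ xs , (s≤s l , b ∷ bs) , p })
           (λ { ([] , _ , p) → inj₁ p
              ; (x ∷ xs , (s≤s l , b ∷ bs) , p) → inj₂ (x , b , xs , (l , bs) , p) })
           (P? [] ⊎-dec s (λ x → searchLists s k (λ xs → P? (x ∷ xs))))

    searchFin : Searchable {Fin n} (λ _ → ⊤)
    searchFin P? = map′ (λ (x , p) → x , tt , p) (λ (x , _ , p) → x , p) (Finₚ.any? P?)

    isPath? : U.Decidable IsPath
    isPath? p = map′ (λ (a , b , c) → isPath a b c)
                     (λ (isPath a b c) → a , b , c)
                     ((1 ≤? length p)
                       ×-dec AllPairs.allPairs? (λ x y → ¬? (x Finₚ.≟ y)) p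
                       ×-dec Linked.linked? Adj? p)

    traverses? : (p : List (Fin n)) (u v : Fin n) → Dec (Traverses p u v)
    traverses? p u v = mem? (u , v) ⊎-dec mem? (v , u)
      where mem? : ∀ x → Dec (x ∈ steps p)
            mem? x = Any.any? (≡-dec Finₚ._≟_ Finₚ._≟_ x) (steps p)

    isPathDecomposition? : U.Decidable IsPathDecomposition
    isPathDecomposition? ps =
      map′ (λ (a , b , c) → isPathDecomposition a b c)
           (λ (isPathDecomposition a b c) → a , b , c)
           (All.all? isPath? ps
             ×-dec AllPairs.allPairs? (λ p q → Finₚ.all? λ u → Finₚ.all? λ v →
                     traverses? p u v →-dec ¬? (traverses? q u v)) ps
             ×-dec (Finₚ.all? λ u → Finₚ.all? λ v →
                     Adj? u v →-dec Any.any? (λ p → traverses? p u v) ps))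

    unique-lookup : ∀ {xs : List (Fin n)} → Unique xs → ∀ i j → lookup xs i ≡ lookup xs j → i ≡ j
    unique-lookup (_ ∷ _)  Fin.zero    Fin.zero    _  = refl
    unique-lookup (h ∷ _)  Fin.zero    (Fin.suc j) eq = contradiction eq (All.lookup h (∈-lookup j))
    unique-lookup (h ∷ _)  (Fin.suc i) Fin.zero    eq = contradiction (sym eq) (All.lookup h (∈-lookup i))
    unique-lookup (_ ∷ us) (Fin.suc i) (Fin.suc j) eq = cong Fin.suc (unique-lookup us i j eq)

    short : ∀ {p} → IsPath p → length p ≤ n × All (λ _ → ⊤) p
    short ip = Finₚ.injective⇒≤ (unique-lookup (IsPath.distinct ip) _ _) , All.universal (λ _ → tt) _

    hasDecompositionOfSize? : U.Decidable HasDecompositionOfSize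
    hasDecompositionOfSize? k =
      map′ (λ (ps , _ , d) → ps , d)
           (λ (ps , l , d) → ps , (≤-reflexive l , All.map short (IsPathDecomposition.paths d)) , l , d)
           (searchLists (searchLists searchFin n) k (λ ps → (length ps ≟ k) ×-dec isPathDecomposition? ps))

    Ordered : Fin n × Fin n → Set
    Ordered (u , v) = toℕ u < toℕ v × Adj u v

    edgePath : Fin n × Fin n → List (Fin n)
    edgePath (u , v) = u ∷ v ∷ []

    edgeIsPath : ∀ {e} → Ordered e → IsPath (edgePath e)
    edgeIsPath (lt , a) =
      isPath (s≤s z≤n) (((λ { refl → <-asym lt lt }) ∷ []) ∷ [] ∷ []) (a ∷ [-])

    edgesDisjoint : ∀ {e e′} → Ordered e → Ordered e′ → e ≢ e′ → EdgeDisjoint (edgePath e) (edgePath e′)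
    edgesDisjoint (l , _) (l′ , _) e≢ _ _ (inj₁ (here refl)) (inj₁ (here refl)) = e≢ refl
    edgesDisjoint (l , _) (l′ , _) e≢ _ _ (inj₁ (here refl)) (inj₂ (here refl)) = <-asym l l′
    edgesDisjoint (l , _) (l′ , _) e≢ _ _ (inj₂ (here refl)) (inj₁ (here refl)) = <-asym l l′
    edgesDisjoint (l , _) (l′ , _) e≢ _ _ (inj₂ (here refl)) (inj₂ (here refl)) = e≢ refl

    allEdgesDisjoint : ∀ {es} → All Ordered es → Unique es → AllPairs (EdgeDisjoint on edgePath) es
    allEdgesDisjoint []       []       = []
    allEdgesDisjoint (o ∷ os) (u ∷ us) =
      All.zipWith (λ (o′ , ≢) → edgesDisjoint o o′ ≢) (os , u) ∷ allEdgesDisjoint os us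

    ordered? : U.Decidable Ordered
    ordered? (u , v) = (toℕ u <? toℕ v) ×-dec Adj? u v

    pairs edgeList : List (Fin n × Fin n)
    pairs    = cartesianProduct (allFin n) (allFin n)
    edgeList = filter ordered? pairs

    edgeDecomposition : IsPathDecomposition (map edgePath edgeList)
    edgeDecomposition = isPathDecomposition
      (Allₚ.map⁺ (All.map edgeIsPath ordered))
      (AllPairsₚ.map⁺ (allEdgesDisjoint ordered unique))
      covers
      where
      ordered : All Ordered edgeList
      ordered = all-filter ordered? pairs

      unique : Unique edgeList
      unique = Uniqueₚ.filter⁺ ordered?
        (Uniqueₚ.cartesianProduct⁺ (Uniqueₚ.allFin⁺ n) (Uniqueₚ.allFin⁺ n))

      listed : ∀ {u v} → Ordered (u , v) → edgePath (u , v) ∈ map edgePath edgeList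
      listed {u} {v} o = ∈-map⁺ edgePath
        (∈-filter⁺ ordered? (∈-cartesianProduct⁺ (∈-allFin u) (∈-allFin v)) o)

      covers : ∀ u v → Adj u v → Any (λ p → Traverses p u v) (map edgePath edgeList)
      covers u v a with <-cmp (toℕ u) (toℕ v)
      ... | tri< u<v _ _ = lose (listed (u<v , a)) (inj₁ (here refl))
      ... | tri> _ _ v<u = lose (listed (v<u , subst T (adj-sym u v) a)) (inj₂ (here refl))
      ... | tri≈ _ u≡v _ with refl ← Finₚ.toℕ-injective u≡v =
        contradiction (subst T (adj-irrefl u) a) (λ ())

    least : {Q : ℕ → Set} → U.Decidable Q → ∀ k → Q k →
            ∃[ m ] (Q m × (∀ j → Q j → m ≤ j))
    least Q? zero q = zero , q , λ _ _ → z≤n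
    least {Q} Q? (suc k) q with Q? zero
    ... | yes q₀ = zero , q₀ , λ _ _ → z≤n
    ... | no ¬q₀ with (m , qm , min) ← least (Q? ∘ suc) k q = suc m , qm , min′
      where min′ : ∀ j → Q j → suc m ≤ j
            min′ zero    q₀ = contradiction q₀ ¬q₀
            min′ (suc j) qj = s≤s (min j qj)

    minimum : ∃[ m ] (HasDecompositionOfSize m × (∀ j → HasDecompositionOfSize j → m ≤ j))
    minimum = least hasDecompositionOfSize? _ (map edgePath edgeList , refl , edgeDecomposition)

  pn : ℕ
  pn = proj₁ minimum

  pn-attained : ∃[ ps ] (length ps ≡ pn × IsPathDecomposition ps)
  pn-attained = proj₁ (proj₂ minimum)

  pn-minimal : ∀ ps → IsPathDecomposition ps → pn ≤ length ps
  pn-minimal ps d = proj₂ (proj₂ minimum) (length ps) (ps , refl , d)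

  Gallai : Set
  Gallai = pn ≤ ⌊ nonIsolated /2⌋

-- Every subgraph H of G with an edge has a path whose removal isolates two
-- vertices, so that the bound follows by induction on the number of
-- non-isolated vertices.
--
-- Two vertices of degree one or two in the same component of H are isolated by
-- one path. Take a path between them. At an end a whose other neighbour is off
-- the path, extend the path to it; if that neighbour is on the path, go from it
-- straight to a and then back to a's former neighbour on the path. This fails
-- only if both vertices lie on a common cycle, which has length at least 6 and
-- hence an edge avoiding both; remove that edge from the cycle.
--
-- Each component of H has two such vertices because a subgraph on w > 0 vertices
-- with h edges has 2h + 3 ≤ 3w. For the latter, delete the other edges of G one
-- by one, maintaining that the cycle rank of the remaining graph is less than
-- its number of face classes. Euler's formula gives this for G; deleting a
-- non-bridge lowers the cycle rank and merges at most two classes, and a bridge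
-- has the same class on both sides. If at least two classes remain, the boundary
-- of each contains a directed cycle, so at least 6 darts.

module Submission where

open import Defs
open import Data.Bool using (Bool; true; false; T; _∧_; not; if_then_else_)
open import Data.Bool.Properties using (T?; T-irrelevant)
import Data.Bool.Properties as Boolₚ
open import Data.Empty using (⊥-elim)
open import Data.Fin using (Fin; toℕ)
open import Data.Fin.Properties as Finₚ using (_≟_)
open import Data.List using (List; []; _∷_; [_]; _++_; length; filter; map; allFin; cartesianProduct; reverse)
import Data.List.Properties as Listₚ
open import Data.List.Membership.Propositional using (_∈_; _∉_; lose)
open import Data.List.Membership.Propositional.Properties
  using (∈-map⁺; ∈-map⁻; ∈-filter⁺; ∈-filter⁻; ∈-cartesianProduct⁺; ∈-allFin; ∈-∃++; ∈-++⁺ˡ; ∈-++⁺ʳ; ∈-++⁻; ∈-length)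
open import Data.List.Relation.Binary.Permutation.Propositional using (_↭_; ↭-sym; ↭-refl; ↭⇒↭ₛ; module PermutationReasoning)
import Data.List.Relation.Binary.Permutation.Setoid.Properties as ↭ₛₚ
import Data.List.Relation.Binary.Permutation.Propositional.Properties as ↭ₚ
import Data.List.Relation.Binary.BagAndSetEquality as BagAndSet
open import Data.List.Membership.Propositional.Properties.WithK using (unique∧set⇒bag)
open import Data.List.Relation.Unary.All as All using (All; []; _∷_)
import Data.List.Relation.Unary.All.Properties as Allₚ
open import Data.List.Relation.Unary.AllPairs as AllPairs using (AllPairs; []; _∷_)
import Data.List.Relation.Unary.AllPairs.Properties as AllPairsₚ
open import Data.List.Relation.Unary.Any as Any using (Any; here; there)
open import Data.List.Relation.Unary.Linked as Linked using (Linked; []; [-]; _∷_)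
open import Data.List.Relation.Unary.Unique.Propositional using (Unique)
import Data.List.Relation.Unary.Unique.Propositional.Properties as Uniqueₚ
open import Data.Nat using (ℕ; zero; suc; _+_; _*_; _≤_; _<_; z≤n; s≤s; ⌊_/2⌋; _<?_; _≤?_)
open import Data.Nat.ListAction using (sum)
open import Data.Nat.ListAction.Properties using (sum-↭; sum-++)
import Data.Nat.Properties as ℕₚ
open import Data.Nat.Solver using (module +-*-Solver)
open import Data.Product using (∃-syntax; _×_; _,_; proj₁; proj₂)
open import Data.Product.Properties using (≡-dec)
open import Data.Sum using (_⊎_; inj₁; inj₂; [_,_]′)
open import Data.Unit using (tt)
open import Function using (_∘_; id; case_of_)
open import Function.Bundles using (Equivalence; Inverse; Surjection; mk⇔)
open import Level using (0ℓ)
open import Relation.Binary using (Rel; IsEquivalence; tri<; tri≈; tri>)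
open import Relation.Binary.Construct.Closure.ReflexiveTransitive as Star using (Star; ε; _◅_; _◅◅_)
open import Relation.Binary.Construct.Closure.Symmetric using (fwd; bwd)
open import Relation.Binary.PropositionalEquality
  using (_≡_; _≢_; refl; sym; trans; cong; cong₂; subst; module ≡-Reasoning)
open import Relation.Binary.PropositionalEquality.Properties using () renaming (setoid to ≡-setoid)
open import Relation.Nullary using (¬_; Dec; yes; no; does; contradiction)
open import Relation.Nullary.Decidable using (dec-true; dec-false; ¬?; _×-dec_; _⊎-dec_)
import Relation.Unary as U

private
  variable
    A B : Set
    m n : ℕ

-- Counting in duplicate-free lists and finite sums

⊆⇒length≤ : {xs ys : List A} → Unique xs → (∀ {x} → x ∈ xs → x ∈ ys) → length xs ≤ length ys
⊆⇒length≤ {xs = []} _ _ = z≤n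
⊆⇒length≤ {xs = x ∷ xs} (x∉ ∷ u) sub with ∈-∃++ (sub (here refl))
... | ys₁ , ys₂ , refl = begin
  suc (length xs)                ≤⟨ s≤s (⊆⇒length≤ u sub′) ⟩
  suc (length (ys₁ ++ ys₂))      ≡⟨ ↭ₚ.↭-length (↭ₚ.shift x ys₁ ys₂) ⟨
  length (ys₁ ++ [ x ] ++ ys₂)   ∎
  where
  open ℕₚ.≤-Reasoning
  sub′ : ∀ {z} → z ∈ xs → z ∈ ys₁ ++ ys₂
  sub′ z∈ with ∈-++⁻ ys₁ (sub (there z∈))
  ... | inj₁ p         = ∈-++⁺ˡ p
  ... | inj₂ (here eq) = contradiction (sym eq) (All.lookup x∉ z∈)
  ... | inj₂ (there p) = ∈-++⁺ʳ ys₁ p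

unique⇒length≤ : {xs : List (Fin n)} → Unique xs → length xs ≤ n
unique⇒length≤ {n} u =
  ℕₚ.≤-trans (⊆⇒length≤ u (λ _ → ∈-allFin _)) (ℕₚ.≤-reflexive (Listₚ.length-tabulate id))

unique-↭ : {xs ys : List A} → xs ↭ ys → Unique xs → Unique ys
unique-↭ p = ↭ₛₚ.Unique-resp-↭ (≡-setoid _) (↭⇒↭ₛ p)

Unique-suffix : ∀ (xs : List A) {ys} → Unique (xs ++ ys) → Unique ys
Unique-suffix []       u       = u
Unique-suffix (_ ∷ xs) (_ ∷ u) = Unique-suffix xs u

ι : Bool → ℕ
ι true  = 1
ι false = 0

∑ : List A → (A → ℕ) → ℕ
∑ xs f = sum (map f xs)

∑-cong : ∀ (xs : List A) {f g} → (∀ x → f x ≡ g x) → ∑ xs f ≡ ∑ xs g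
∑-cong xs eq = cong sum (Listₚ.map-cong eq xs)

∑-mono : ∀ (xs : List A) {f g} → (∀ {x} → x ∈ xs → f x ≤ g x) → ∑ xs f ≤ ∑ xs g
∑-mono []       le = z≤n
∑-mono (x ∷ xs) le = ℕₚ.+-mono-≤ (le (here refl)) (∑-mono xs (le ∘ there))

∑-strict : ∀ {xs : List A} {f g} → (∀ x → f x ≤ g x) → ∀ {y} → y ∈ xs → f y < g y → ∑ xs f < ∑ xs g
∑-strict {xs = x ∷ xs} le (here refl) lt = ℕₚ.+-mono-<-≤ lt (∑-mono xs (λ _ → le _))
∑-strict {xs = x ∷ xs} le (there y∈)  lt = ℕₚ.+-mono-≤-< (le x) (∑-strict le y∈ lt)

∑-+ : ∀ (xs : List A) f g → ∑ xs (λ x → f x + g x) ≡ ∑ xs f + ∑ xs g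
∑-+ []       f g = refl
∑-+ (x ∷ xs) f g = trans (cong (f x + g x +_) (∑-+ xs f g)) (interchange (f x) (g x) _ _)
  where
  interchange : ∀ a b c d → (a + b) + (c + d) ≡ (a + c) + (b + d)
  interchange = solve 4 (λ a b c d → (a :+ b) :+ (c :+ d) := (a :+ c) :+ (b :+ d)) refl
    where open +-*-Solver

∑-zero : ∀ (xs : List A) → ∑ xs (λ _ → 0) ≡ 0
∑-zero []       = refl
∑-zero (x ∷ xs) = ∑-zero xs

∑-const : ∀ (xs : List A) k → ∑ xs (λ _ → k) ≡ length xs * k
∑-const []       k = refl
∑-const (x ∷ xs) k = cong (k +_) (∑-const xs k)

∑-*ˡ : ∀ (xs : List A) k f → ∑ xs (λ x → k * f x) ≡ k * ∑ xs f
∑-*ˡ []       k f = sym (ℕₚ.*-zeroʳ k)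
∑-*ˡ (x ∷ xs) k f = trans (cong (k * f x +_) (∑-*ˡ xs k f)) (sym (ℕₚ.*-distribˡ-+ k (f x) _))

∑-swap : ∀ (xs : List A) (ys : List B) (f : A → B → ℕ) → ∑ xs (λ x → ∑ ys (f x)) ≡ ∑ ys (λ y → ∑ xs (λ x → f x y))
∑-swap []       ys f = sym (∑-zero ys)
∑-swap (x ∷ xs) ys f = trans (cong (∑ ys (f x) +_) (∑-swap xs ys f)) (sym (∑-+ ys (f x) _))

∑-↭ : ∀ {xs ys : List A} f → xs ↭ ys → ∑ xs f ≡ ∑ ys f
∑-↭ f p = sum-↭ (↭ₚ.map⁺ f p)

∑-filter : ∀ {P : A → Set} (P? : U.Decidable P) xs → length (filter P? xs) ≡ ∑ xs (λ x → ι (does (P? x)))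
∑-filter P? []       = refl
∑-filter P? (x ∷ xs) with does (P? x)
... | true  = cong suc (∑-filter P? xs)
... | false = ∑-filter P? xs

-- A bijection turns a duplicate-free list of all elements into another such list, hence into a
-- permutation of the first.
∑-reindex : ∀ {xs : List A} → Unique xs → (∀ x → x ∈ xs) → ∀ {g h : A → A} →
            (∀ x → g (h x) ≡ x) → (∀ x → h (g x) ≡ x) → ∀ f → ∑ xs (f ∘ g) ≡ ∑ xs f
∑-reindex {xs = xs} u all {g} {h} gh hg f =
  trans (cong sum (Listₚ.map-∘ xs)) (∑-↭ f (BagAndSet.∼bag⇒↭ (unique∧set⇒bag u′ u set)))
  where
  u′ : Unique (map g xs)
  u′ = Uniqueₚ.map⁺ (λ {x} {y} eq → trans (sym (hg x)) (trans (cong h eq) (hg y))) u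
  set : ∀ {x} → _
  set {x} = mk⇔ (λ _ → all x) (λ _ → subst (_∈ map g xs) (gh x) (∈-map⁺ g (all (h x))))

∑-absent : ∀ (xs : List (Fin n)) {y} → All (y ≢_) xs → ∑ xs (λ x → ι (does (x ≟ y))) ≡ 0
∑-absent []       []         = refl
∑-absent (x ∷ xs) {y} (≢ ∷ y∉) rewrite dec-false (x ≟ y) (≢ ∘ sym) = ∑-absent xs y∉

∑-single : ∀ {xs : List (Fin n)} {y} → Unique xs → y ∈ xs → ∑ xs (λ x → ι (does (x ≟ y))) ≡ 1
∑-single {xs = x ∷ xs} {y} (x∉ ∷ u) (here refl)
  rewrite dec-true (x ≟ x) refl = cong suc (∑-absent xs x∉)
∑-single {xs = x ∷ xs} {y} (x∉ ∷ u) (there y∈)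
  rewrite dec-false (x ≟ y) (All.lookup x∉ y∈) = ∑-single u y∈

∑Fin-single : ∀ (y : Fin n) → ∑ (allFin n) (λ x → ι (does (x ≟ y))) ≡ 1
∑Fin-single {n} y = ∑-single (Uniqueₚ.allFin⁺ n) (∈-allFin y)

∑Fin-const : ∀ n k → ∑ (allFin n) (λ _ → k) ≡ n * k
∑Fin-const n k = trans (∑-const (allFin n) k) (cong (_* k) (Listₚ.length-tabulate {n = n} id))

-- Union-find

-- The canonical representative of `z` in the equivalence relation generated by the pairs. A new
-- pair redirects the class of `y` to the representative of `x`.
label : List (Fin m × Fin m) → Fin m → Fin m
label []            z = z
label ((x , y) ∷ L) z = if does (label L z ≟ label L y) then label L x else label L z

-- The number of pairs that merge two classes when they are added: the size of a spanning forest of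
-- the graph with these edges.
rank : List (Fin m × Fin m) → ℕ
rank []            = 0
rank ((x , y) ∷ L) = if does (label L x ≟ label L y) then rank L else suc (rank L)

-- A class contains exactly one root, its label, so `roots` below is the number of classes.
Root : List (Fin m × Fin m) → Fin m → Set
Root L z = label L z ≡ z

root? : (L : List (Fin m × Fin m)) → U.Decidable (Root L)
root? L z = label L z ≟ z

roots : List (Fin m × Fin m) → ℕ
roots {m} L = ∑ (allFin m) (λ z → ι (does (root? L z)))

module _ {m : ℕ} where

  label-idem : ∀ (L : List (Fin m × Fin m)) z → label L (label L z) ≡ label L z
  label-idem []            z = refl
  label-idem ((x , y) ∷ L) z with label L z ≟ label L y
  ... | no z≢y rewrite label-idem L z | dec-false (label L z ≟ label L y) z≢y = refl
  ... | yes _ rewrite label-idem L x with label L x ≟ label L y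
  ...   | yes _ = refl
  ...   | no _  = refl

  label-joins : ∀ (L : List (Fin m × Fin m)) {x y} → (x , y) ∈ L → label L x ≡ label L y
  label-joins ((x , y) ∷ L) (here refl) rewrite dec-true (label L y ≟ label L y) refl
    with label L x ≟ label L y
  ... | yes _ = refl
  ... | no _  = refl
  label-joins ((x , y) ∷ L) (there p) rewrite label-joins L p = refl

  -- Converse of `label-joins`: redirecting the class of `y` to the label of `x` stays within every
  -- equivalence relation that contains the pairs.
  label-related : ∀ {R : Rel (Fin m) 0ℓ} → IsEquivalence R → ∀ (L : List (Fin m × Fin m)) →
                  (∀ {x y} → (x , y) ∈ L → R x y) → ∀ z → R (label L z) z
  label-related eqv []            h z = IsEquivalence.refl eqv
  label-related {R} eqv ((x , y) ∷ L) h z with label L z ≟ label L y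
  ... | no _  = label-related eqv L (h ∘ there) z
  ... | yes e = E.trans (lr x) (E.trans (h (here refl)) (E.trans (E.sym (lr y)) (subst (λ w → R w z) e (lr z))))
    where
    module E = IsEquivalence eqv
    lr = label-related eqv L (h ∘ there)

  -- A pair that merges two classes destroys exactly one root, namely `label L y`; any other pair
  -- changes neither number.
  rank+roots : ∀ (L : List (Fin m × Fin m)) → rank L + roots L ≡ m
  rank+roots [] = trans (∑-cong (allFin m) λ z → cong ι (dec-true (z ≟ z) refl))
                        (trans (∑Fin-const m 1) (ℕₚ.*-identityʳ m))
  rank+roots ((x , y) ∷ L) with label L x ≟ label L y
  ... | yes x≡y = trans (cong (rank L +_) (∑-cong (allFin m) unchanged)) (rank+roots L)
    where
    unchanged : ∀ z → ι (does ((if does (label L z ≟ label L y) then label L x else label L z) ≟ z))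
                      ≡ ι (does (root? L z))
    unchanged z with label L z ≟ label L y
    ... | no _  = refl
    ... | yes e rewrite e | x≡y = refl
  ... | no x≢y = begin
    suc (rank L) + ∑ (allFin m) new
      ≡⟨ solve 2 (λ a b → con 1 :+ a :+ b := a :+ (b :+ con 1)) refl (rank L) (∑ (allFin m) new) ⟩
    rank L + (∑ (allFin m) new + 1)
      ≡⟨ cong (λ k → rank L + (∑ (allFin m) new + k)) (∑Fin-single (label L y)) ⟨
    rank L + (∑ (allFin m) new + ∑ (allFin m) (λ z → ι (does (z ≟ label L y))))
      ≡⟨ cong (rank L +_) (∑-+ (allFin m) new _) ⟨
    rank L + ∑ (allFin m) (λ z → new z + ι (does (z ≟ label L y)))
      ≡⟨ cong (rank L +_) (∑-cong (allFin m) drop) ⟩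
    rank L + roots L
      ≡⟨ rank+roots L ⟩
    m ∎
    where
    open ≡-Reasoning
    open +-*-Solver
    new : Fin m → ℕ
    new z = ι (does ((if does (label L z ≟ label L y) then label L x else label L z) ≟ z))
    drop : ∀ z → new z + ι (does (z ≟ label L y)) ≡ ι (does (root? L z))
    drop z with z ≟ label L y
    ... | yes refl rewrite label-idem L y | dec-true (label L y ≟ label L y) refl
        | dec-false (label L x ≟ label L y) x≢y = refl
    ... | no z≢ with label L z ≟ label L y
    ...   | no _  = ℕₚ.+-identityʳ _
    ...   | yes e rewrite e | dec-false (label L y ≟ z) (z≢ ∘ sym)
            | dec-false (label L x ≟ z) (λ q → x≢y (trans (sym (label-idem L x)) (trans (cong (label L) q) e))) = refl

  rank-∷-≤ : ∀ (L : List (Fin m × Fin m)) p → rank (p ∷ L) ≤ suc (rank L)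
  rank-∷-≤ L (x , y) with label L x ≟ label L y
  ... | yes _ = ℕₚ.n≤1+n _
  ... | no _  = ℕₚ.≤-refl

  roots-≤1 : ∀ (L : List (Fin m × Fin m)) c → (∀ z → label L z ≡ c) → roots L ≤ 1
  roots-≤1 L c const = ℕₚ.≤-trans (∑-mono (allFin m) (λ {z} _ → le z)) (ℕₚ.≤-reflexive (∑Fin-single c))
    where
    le : ∀ z → ι (does (root? L z)) ≤ ι (does (z ≟ c))
    le z with root? L z
    ... | no _  = z≤n
    ... | yes r rewrite dec-true (z ≟ c) (trans (sym r) (const z)) = ℕₚ.≤-refl

  -- The vertices outside W are roots, and so is the label of w₀ ∈ W.
  rank<support : ∀ (L : List (Fin m × Fin m)) (W : Fin m → Bool) {w₀} → T (W w₀) →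
                 (∀ {x y} → (x , y) ∈ L → T (W x) × T (W y)) → rank L < ∑ (allFin m) (ι ∘ W)
  rank<support L W {w₀} w₀∈ inside = ℕₚ.+-cancelʳ-≤ (roots L) _ _ (begin
    suc (rank L + roots L)                                    ≡⟨ cong suc (rank+roots L) ⟩
    suc m                                                     ≡⟨ ℕₚ.+-comm 1 m ⟩
    m + 1                                                     ≡⟨ cong₂ _+_ (trans (∑Fin-const m 1) (ℕₚ.*-identityʳ m)) (∑Fin-single r) ⟨
    ∑ (allFin m) (λ _ → 1) + ∑ (allFin m) (λ z → ι (does (z ≟ r)))  ≡⟨ ∑-+ (allFin m) _ _ ⟨
    ∑ (allFin m) (λ z → 1 + ι (does (z ≟ r)))                 ≤⟨ ∑-mono (allFin m) (λ {z} _ → le z) ⟩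
    ∑ (allFin m) (λ z → ι (W z) + ι (does (root? L z)))       ≡⟨ ∑-+ (allFin m) _ _ ⟩
    ∑ (allFin m) (ι ∘ W) + roots L                            ∎)
    where
    open ℕₚ.≤-Reasoning
    r = label L w₀
    -- All pairs of `L` lie in this relation. Hence a label can differ from its vertex only if both
    -- lie in `W`.
    _~_ : Rel (Fin m) 0ℓ
    x ~ y = x ≡ y ⊎ (T (W x) × T (W y))
    ~-trans : ∀ {x y z} → x ~ y → y ~ z → x ~ z
    ~-trans (inj₁ refl) q = q
    ~-trans p (inj₁ refl) = p
    ~-trans (inj₂ (p , _)) (inj₂ (_ , q)) = inj₂ (p , q)
    ~-equivalence : IsEquivalence _~_
    ~-equivalence = record
      { refl  = inj₁ refl
      ; sym   = λ { (inj₁ e) → inj₁ (sym e) ; (inj₂ (p , q)) → inj₂ (q , p) }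
      ; trans = ~-trans }
    label~ : ∀ z → label L z ~ z
    label~ = label-related ~-equivalence L (inj₂ ∘ inside)
    r∈W : T (W r)
    r∈W with label~ w₀
    ... | inj₁ eq      = subst (T ∘ W) (sym eq) w₀∈
    ... | inj₂ (p , _) = p
    le : ∀ z → 1 + ι (does (z ≟ r)) ≤ ι (W z) + ι (does (root? L z))
    le z with z ≟ r
    le z | yes refl rewrite dec-true (root? L r) (label-idem L w₀) with W r in eq
    ... | true  = ℕₚ.≤-refl
    ... | false = contradiction r∈W (subst T eq)
    le z | no _ with W z in eq
    ... | true  = s≤s z≤n
    ... | false with label~ z
    ...   | inj₁ root rewrite dec-true (root? L z) root = ℕₚ.≤-refl
    ...   | inj₂ (_ , z∈) = contradiction z∈ (subst T eq)

-- Darts and faces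

module _ {n : ℕ} (H : Graph n) where
  open Graph H

  Adj-sym : ∀ {u v} → Adj u v → Adj v u
  Adj-sym {u} {v} = subst T (adj-sym u v)

  ¬Adj-self : ∀ {u} → ¬ Adj u u
  ¬Adj-self {u} = subst T (adj-irrefl u)

module _ {n : ℕ} (G : Graph n) where
  open Graph G
  open Dart

  rev-rev : ∀ d → rev G (rev G d) ≡ d
  rev-rev (dart u v e) = cong (dart u v) (T-irrelevant _ _)

  dart-≡ : ∀ {d d′ : Dart G} → src d ≡ src d′ → tgt d ≡ tgt d′ → d ≡ d′
  dart-≡ {dart u v e} {dart _ _ e′} refl refl = cong (dart u v) (T-irrelevant e e′)

  dartsIn : List (Fin n × Fin n) → List (Dart G)
  dartsIn []             = []
  dartsIn ((u , v) ∷ ps) with Adj? u v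
  ... | yes e = dart u v e ∷ dartsIn ps
  ... | no _  = dartsIn ps

  ∈-dartsIn⁺ : ∀ {ps} d → (src d , tgt d) ∈ ps → d ∈ dartsIn ps
  ∈-dartsIn⁺ {(u , v) ∷ ps} d d∈ with Adj? u v
  ∈-dartsIn⁺ d (here refl) | yes e = here (dart-≡ refl refl)
  ∈-dartsIn⁺ d (there d∈)  | yes e = there (∈-dartsIn⁺ d d∈)
  ∈-dartsIn⁺ d (here refl) | no ¬e = contradiction (edge d) ¬e
  ∈-dartsIn⁺ d (there d∈)  | no _  = ∈-dartsIn⁺ d d∈

  ∈-dartsIn⁻ : ∀ ps {d} → d ∈ dartsIn ps → (src d , tgt d) ∈ ps
  ∈-dartsIn⁻ ((u , v) ∷ ps) d∈ with Adj? u v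
  ∈-dartsIn⁻ ((u , v) ∷ ps) (here refl) | yes e = here refl
  ∈-dartsIn⁻ ((u , v) ∷ ps) (there d∈)  | yes e = there (∈-dartsIn⁻ ps d∈)
  ∈-dartsIn⁻ ((u , v) ∷ ps) d∈          | no _  = there (∈-dartsIn⁻ ps d∈)

  dartsIn-unique : ∀ {ps} → Unique ps → Unique (dartsIn ps)
  dartsIn-unique {[]}           []       = []
  dartsIn-unique {(u , v) ∷ ps} (x∉ ∷ U) with Adj? u v
  ... | yes e = All.tabulate (λ d∈ → λ { refl → All.lookup x∉ (∈-dartsIn⁻ ps d∈) refl }) ∷ dartsIn-unique U
  ... | no _  = dartsIn-unique U

  darts : List (Dart G)
  darts = dartsIn (cartesianProduct (allFin n) (allFin n))

  ∈-darts : ∀ d → d ∈ darts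
  ∈-darts d = ∈-dartsIn⁺ d (∈-cartesianProduct⁺ (∈-allFin _) (∈-allFin _))

  darts-unique : Unique darts
  darts-unique = dartsIn-unique (Uniqueₚ.cartesianProduct⁺ (Uniqueₚ.allFin⁺ n) (Uniqueₚ.allFin⁺ n))

  ∑-rev : ∀ g → ∑ darts (g ∘ rev G) ≡ ∑ darts g
  ∑-rev = ∑-reindex darts-unique ∈-darts rev-rev rev-rev

  _⊆ᴳ_ : Graph n → Graph n → Set
  K ⊆ᴳ L = ∀ {u v} → Graph.Adj K u v → Graph.Adj L u v

  ∑-dartsIn : ∀ (K : Graph n) → K ⊆ᴳ G → ∀ ps →
              ∑ (dartsIn ps) (λ d → ι (Graph.adj K (src d) (tgt d))) ≡ ∑ ps (λ (u , v) → ι (Graph.adj K u v))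
  ∑-dartsIn K sub []             = refl
  ∑-dartsIn K sub ((u , v) ∷ ps) with Adj? u v
  ... | yes e = cong (ι (Graph.adj K u v) +_) (∑-dartsIn K sub ps)
  ... | no ¬e with Graph.adj K u v in eq
  ...   | true  = contradiction (sub (subst T (sym eq) tt)) ¬e
  ...   | false = ∑-dartsIn K sub ps

  ∑-product : ∀ (xs : List A) (ys : List B) (g : A × B → ℕ) →
              ∑ (cartesianProduct xs ys) g ≡ ∑ xs (λ x → ∑ ys (λ y → g (x , y)))
  ∑-product []       ys g = refl
  ∑-product (x ∷ xs) ys g = trans (cong sum (Listₚ.map-++ g (map (x ,_) ys) _))
    (trans (sum-++ (map g (map (x ,_) ys)) _)
           (cong₂ _+_ (cong sum (sym (Listₚ.map-∘ ys))) (∑-product xs ys g)))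

  degreeSum : Graph n → ℕ
  degreeSum K = ∑ (allFin n) (Graph.degree K)

  -- Both sides count the ordered adjacent pairs of `K`. Summing over the darts of `G` gives all
  -- subgraphs one index list, on which the rotation acts.
  handshake : ∀ (K : Graph n) → K ⊆ᴳ G → degreeSum K ≡ ∑ darts (λ d → ι (Graph.adj K (src d) (tgt d)))
  handshake K sub = begin
    ∑ (allFin n) (Graph.degree K)
      ≡⟨ ∑-cong (allFin n) (λ v → ∑-filter (Graph.Adj? K v) (allFin n)) ⟩
    ∑ (allFin n) (λ v → ∑ (allFin n) (λ u → ι (Graph.adj K v u)))
      ≡⟨ ∑-product (allFin n) (allFin n) _ ⟨
    ∑ (cartesianProduct (allFin n) (allFin n)) (λ (u , v) → ι (Graph.adj K u v))
      ≡⟨ ∑-dartsIn K sub (cartesianProduct (allFin n) (allFin n)) ⟨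
    ∑ darts (λ d → ι (Graph.adj K (src d) (tgt d))) ∎
    where open ≡-Reasoning

  Ascending : Dart G → Set
  Ascending d = toℕ (src d) < toℕ (tgt d)

  ascending? : U.Decidable Ascending
  ascending? d = toℕ (src d) <? toℕ (tgt d)

  ascending⊎ : ∀ d → Ascending d ⊎ Ascending (rev G d)
  ascending⊎ d with ℕₚ.<-cmp (toℕ (src d)) (toℕ (tgt d))
  ... | tri< lt _ _ = inj₁ lt
  ... | tri> _ _ gt = inj₂ gt
  ... | tri≈ _ eq _ with dart u v e ← d with refl ← Finₚ.toℕ-injective eq = ⊥-elim (¬Adj-self G e)

  -- Every dart or its reverse is ascending, but not both.
  ∑-ascending : ∀ (P : Dart G → Bool) → (∀ d → P (rev G d) ≡ P d) →
                ∑ darts (λ d → ι (P d)) ≡ 2 * ∑ darts (λ d → ι (does (ascending? d) ∧ P d))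
  ∑-ascending P P-rev = begin
    ∑ darts (λ d → ι (P d))         ≡⟨ ∑-cong darts split ⟩
    ∑ darts (λ d → f d + f (rev G d)) ≡⟨ ∑-+ darts f _ ⟩
    ∑ darts f + ∑ darts (f ∘ rev G)  ≡⟨ cong (∑ darts f +_) (trans (∑-rev f) (sym (ℕₚ.+-identityʳ _))) ⟩
    2 * ∑ darts f                    ∎
    where
    open ≡-Reasoning
    f : Dart G → ℕ
    f d = ι (does (ascending? d) ∧ P d)
    split : ∀ d → ι (P d) ≡ f d + f (rev G d)
    split d rewrite P-rev d with ascending⊎ d
    ... | inj₁ lt rewrite dec-true (ascending? d) lt | dec-false (ascending? (rev G d)) (ℕₚ.<-asym lt) =
      sym (ℕₚ.+-identityʳ _)
    ... | inj₂ gt rewrite dec-true (ascending? (rev G d)) gt | dec-false (ascending? d) (ℕₚ.<-asym gt) = refl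

  -- Boundaries of the classes of a face colouring

  module _ (R : RotationSystem G) where
    open RotationSystem R

    -- a is the colouring of the darts by the faces left after some edges are deleted.
    module _ {f : ℕ} (a : Dart G → Fin f) (a-face : ∀ d → a (face d) ≡ a d) where

      a-next : ∀ d → a (next d) ≡ a (rev G d)
      a-next d = trans (cong (a ∘ next) (sym (rev-rev d))) (a-face (rev G d))

      -- A conservation law: at every vertex, as many darts with colour in `χ` leave as enter.
      -- Indeed `next` permutes the darts without moving their sources, and `next d` has the colour
      -- of `rev G d`.
      balance : ∀ (W : Fin n → Bool) (χ : Fin f → Bool) →
                ∑ darts (λ d → ι (W (src d)) * ι (χ (a d))) ≡ ∑ darts (λ d → ι (W (src d)) * ι (χ (a (rev G d))))
      balance W χ = trans
        (sym (∑-reindex darts-unique ∈-darts (Inverse.strictlyInverseˡ rotation) (Inverse.strictlyInverseʳ rotation) g))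
        (∑-cong darts λ d → cong₂ (λ u c → ι (W u) * ι (χ c)) (fixesSrc d) (a-next d))
        where
        g : Dart G → ℕ
        g d = ι (W (src d)) * ι (χ (a d))

      -- An edge d₀ that is the only one between U-classes has the same colour on
      -- both sides: the boundary of the colour of d₀ leaves the class of src d₀
      -- as often as it enters it.
      jordan : ∀ {k} (U : Fin n → Fin k) d₀ →
               (∀ d → (d ≡ d₀ ⊎ d ≡ rev G d₀) ⊎ (a d ≡ a (rev G d) ⊎ U (src d) ≡ U (tgt d))) →
               U (src d₀) ≢ U (tgt d₀) → a d₀ ≡ a (rev G d₀)
      jordan U d₀ only U≢ with a (rev G d₀) ≟ a d₀
      ... | yes eq = sym eq
      ... | no a≢  = contradiction total≡ (ℕₚ.<⇒≢ total<)
        where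
        W : Fin n → Bool
        W z = does (U z ≟ U (src d₀))
        χ : Fin f → Bool
        χ c = does (c ≟ a d₀)
        φ ψ : Dart G → ℕ
        φ d = ι (W (src d)) * ι (χ (a d))
        ψ d = ι (W (src d)) * ι (χ (a (rev G d)))
        total≡ : ∑ darts (λ d → ψ d + ψ (rev G d)) ≡ ∑ darts (λ d → φ d + φ (rev G d))
        total≡ = begin
          ∑ darts (λ d → ψ d + ψ (rev G d))  ≡⟨ ∑-+ darts ψ _ ⟩
          ∑ darts ψ + ∑ darts (ψ ∘ rev G)    ≡⟨ cong (∑ darts ψ +_) (∑-rev ψ) ⟩
          ∑ darts ψ + ∑ darts ψ              ≡⟨ cong (λ x → x + x) (balance W χ) ⟨
          ∑ darts φ + ∑ darts φ              ≡⟨ cong (∑ darts φ +_) (∑-rev φ) ⟨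
          ∑ darts φ + ∑ darts (φ ∘ rev G)    ≡⟨ ∑-+ darts φ _ ⟨
          ∑ darts (λ d → φ d + φ (rev G d))  ∎
          where open ≡-Reasoning
        -- As `tgt d₀` lies outside `W`, only the terms of `d₀` itself can be nonzero, and `χ` holds
        -- for the colour of `d₀` but not for that of its reverse.
        at-d₀ : (ψ d₀ + ψ (rev G d₀) ≡ 0) × (φ d₀ + φ (rev G d₀) ≡ 1)
        at-d₀ rewrite rev-rev d₀ | dec-true (U (src d₀) ≟ U (src d₀)) refl
          | dec-false (U (tgt d₀) ≟ U (src d₀)) (U≢ ∘ sym)
          | dec-true (a d₀ ≟ a d₀) refl | dec-false (a (rev G d₀) ≟ a d₀) a≢ = refl , refl
        ψ≤φ : ∀ d → ψ d + ψ (rev G d) ≤ φ d + φ (rev G d)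
        ψ≤φ d with only d
        ... | inj₁ (inj₁ refl) rewrite proj₁ at-d₀ = z≤n
        ... | inj₁ (inj₂ refl) = ℕₚ.≤-trans (ℕₚ.≤-reflexive
          (trans (cong (λ e → ψ (rev G d₀) + ψ e) (rev-rev d₀)) (trans (ℕₚ.+-comm (ψ (rev G d₀)) _) (proj₁ at-d₀)))) z≤n
        ... | inj₂ (inj₁ eq) rewrite rev-rev d | eq = ℕₚ.≤-refl
        ... | inj₂ (inj₂ eq) rewrite rev-rev d | eq =
          ℕₚ.≤-reflexive (ℕₚ.+-comm (ι (W (tgt d)) * ι (χ (a (rev G d)))) _)
        total< : ∑ darts (λ d → ψ d + ψ (rev G d)) < ∑ darts (λ d → φ d + φ (rev G d))
        total< = ∑-strict ψ≤φ (∈-darts d₀) (ℕₚ.≤-reflexive (trans (cong suc (proj₁ at-d₀)) (sym (proj₂ at-d₀))))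

      module _ (c : Fin f) where

        Boundary : Dart G → Set
        Boundary d = a d ≡ c × a (rev G d) ≢ c

        boundary? : U.Decidable Boundary
        boundary? d = (a d ≟ c) ×-dec ¬? (a (rev G d) ≟ c)

        -- Balance at `tgt d`: the dart `rev G d` leaves that vertex with colour `c` only across it,
        -- so another dart must leave with colour `c` only on its own side.
        advance : ∀ {d} → Boundary d → ∃[ e ] (src e ≡ tgt d × Boundary e)
        advance {d} (ad , ard) with Any.any? (λ e → (src e ≟ tgt d) ×-dec boundary? e) darts
        ... | yes found = Any.satisfied found
        ... | no none = contradiction (balance W χ) (ℕₚ.<⇒≢ (∑-strict le (∈-darts (rev G d)) lt))
          where
          W : Fin n → Bool
          W z = does (z ≟ tgt d)
          χ : Fin f → Bool
          χ k = does (k ≟ c)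
          le : ∀ e → ι (W (src e)) * ι (χ (a e)) ≤ ι (W (src e)) * ι (χ (a (rev G e)))
          le e with src e ≟ tgt d | a e ≟ c | a (rev G e) ≟ c
          ... | no _  | _     | _     = z≤n
          ... | yes _ | no _  | _     = z≤n
          ... | yes _ | yes _ | yes _ = ℕₚ.≤-refl
          ... | yes p | yes q | no r  = contradiction (lose (∈-darts e) (p , q , r)) none
          lt : ι (W (tgt d)) * ι (χ (a (rev G d))) < ι (W (tgt d)) * ι (χ (a (rev G (rev G d))))
          lt rewrite rev-rev d | dec-true (tgt d ≟ tgt d) refl | dec-true (a d ≟ c) ad
            | dec-false (a (rev G d) ≟ c) ard = s≤s z≤n

        -- A directed path of boundary darts, the last dart first.
        data Chain : Fin n → List (Dart G) → Set where
          []   : ∀ {x} → Chain x []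
          push : ∀ {e es} → Boundary e → Chain (src e) es → Chain (tgt e) (e ∷ es)

        Chain⇒Boundary : ∀ {x es} → Chain x es → All Boundary es
        Chain⇒Boundary []         = []
        Chain⇒Boundary (push b C) = b ∷ Chain⇒Boundary C

        -- Drops the darts travelled before `y`, to leave a path from `y` to `x`. Its vertices are
        -- listed backwards, so the link remains to be closed at `y` by a further neighbour `z`.
        cut : ∀ {x y es} → Chain x es → y ∈ map src es →
              ∃[ es₁ ] ∃[ es₂ ] (es ≡ es₁ ++ es₂ × Chain x es₁ × y ∈ map src es₁ ×
                                 (∀ {z} → Adj y z → Linked Adj (x ∷ map src es₁ ++ [ z ])))
        cut (push {e} {es} b C) (here refl) =
          [ e ] , es , refl , push b [] , here refl , λ yz → edge (rev G e) ∷ yz ∷ [-]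
        cut (push {e} b C) (there y∈) with es₁ , es₂ , refl , C₁ , y∈₁ , link ← cut C y∈ =
          e ∷ es₁ , es₂ , refl , push b C₁ , there y∈₁ , λ yz → edge (rev G e) ∷ link yz

        BoundaryCycle : Set
        BoundaryCycle = ∃[ ds ] (6 ≤ length ds × Unique ds × All Boundary ds)

        module _ (girth : GirthAtLeast G 6) where

          close : ∀ {d es} → Boundary d → Chain (src d) es → Unique (src d ∷ map src es) →
                  tgt d ∈ map src es → BoundaryCycle
          close {d} bd C distinct y∈ with cut C y∈
          ... | es₁ , es₂ , refl , C₁ , y∈₁ , link =
            d ∷ es₁
              , subst (6 ≤_) (Listₚ.length-map src (d ∷ es₁)) (girth (src d) (map src es₁) isCycle)
              , Uniqueₚ.map⁻ distinct₁
              , bd ∷ Chain⇒Boundary C₁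
            where
            distinct₁ : Unique (map src (d ∷ es₁))
            distinct₁ = Unique-suffix (map src es₂) (unique-↭ (↭ₚ.++-comm (map src (d ∷ es₁)) (map src es₂))
              (subst Unique (Listₚ.map-++ src (d ∷ es₁) es₂) distinct))
            -- A single dart here would be `rev G d`; but the reverse of a boundary dart does not
            -- have colour `c`, whereas `d` does.
            atLeast3 : ∀ {x es} → src d ≡ x → Chain x es → tgt d ∈ map src es → 2 ≤ length (map src es)
            atLeast3 src≡ (push be []) (here tgt≡) =
              contradiction (trans (cong a (dart-≡ (sym src≡) (sym tgt≡))) (proj₁ bd)) (proj₂ be)
            atLeast3 _ (push _ (push _ _)) _ = s≤s (s≤s z≤n)
            isCycle : IsCycle G (src d) (map src es₁)
            isCycle = record { atLeast3 = atLeast3 refl C₁ y∈₁ ; distinct = distinct₁ ; closed = link (edge (rev G d)) }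

          -- Follows `advance` until a vertex repeats, which closes a cycle. The number `k` is fuel:
          -- the `2 + length es` vertices are distinct, so it cannot run out.
          grow : ∀ k {e es} → n ≤ k + length es → Boundary e → Chain (src e) es →
                 Unique (tgt e ∷ src e ∷ map src es) → BoundaryCycle
          grow zero {e} {es} n≤ b C distinct = contradiction (unique⇒length≤ distinct)
            (ℕₚ.<⇒≱ (s≤s (ℕₚ.≤-trans n≤ (ℕₚ.≤-trans (ℕₚ.≤-reflexive (sym (Listₚ.length-map src es))) (ℕₚ.n≤1+n _)))))
          grow (suc k) {e} {es} n≤ b C distinct with advance b
          ... | d , src≡ , bd with Any.any? (tgt d ≟_) (tgt e ∷ src e ∷ map src es)
          ...   | yes (here eq) = ⊥-elim (¬Adj-self G (subst (λ z → Adj z (tgt d)) (trans src≡ (sym eq)) (edge d)))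
          ...   | yes (there y∈) = close bd (subst (λ z → Chain z (e ∷ es)) (sym src≡) (push b C))
            (subst (λ z → Unique (z ∷ src e ∷ map src es)) (sym src≡) distinct) y∈
          ...   | no y∉ = grow k (ℕₚ.≤-trans n≤ (ℕₚ.≤-reflexive (sym (ℕₚ.+-suc k _)))) bd
            (subst (λ z → Chain z (e ∷ es)) (sym src≡) (push b C))
            (subst (λ z → Unique (tgt d ∷ z ∷ src e ∷ map src es)) (sym src≡) (Allₚ.¬Any⇒All¬ _ y∉ ∷ distinct))

          boundaryCycle : ∀ {e} → Boundary e → BoundaryCycle
          boundaryCycle {e} b = grow n (ℕₚ.m≤m+n n 0) b []
            (((λ eq → ¬Adj-self G (subst (Adj (src e)) eq (edge e))) ∷ []) ∷ [] ∷ [])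

        -- Without boundary darts the colour `c` passes across every edge, hence around every vertex
        -- by the rotation and along every walk, and so reaches `d′`.
        boundaryDart : Connected → ∀ d d′ → a d ≡ c → a d′ ≢ c → ∃[ e ] Boundary e
        boundaryDart connected d d′ ad ad′ with Any.any? boundary? darts
        ... | yes found = Any.satisfied found
        ... | no none = contradiction (spread (connected (src d) (src d′)) (around d ad) d′ refl) ad′
          where
          across : ∀ x → a x ≡ c → a (rev G x) ≡ c
          across x ax with a (rev G x) ≟ c
          ... | yes eq = eq
          ... | no ≢   = contradiction (lose (∈-darts x) (ax , ≢)) none
          orbit : ∀ {x y} → SameOrbit next x y → a x ≡ c → a y ≡ c
          orbit ε                    ax = ax
          orbit (fwd refl ◅ s) ax = orbit s (trans (a-next _) (across _ ax))
          orbit (bwd refl ◅ s) ax =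
            orbit s (trans (sym (cong a (rev-rev _))) (across _ (trans (sym (a-next _)) ax)))
          around : ∀ x → a x ≡ c → ∀ y → src y ≡ src x → a y ≡ c
          around x ax y eq = orbit (transitive x y (sym eq)) ax
          spread : ∀ {u v} → Star Adj u v → (∀ y → src y ≡ u → a y ≡ c) → ∀ y → src y ≡ v → a y ≡ c
          spread ε              here-c = here-c
          spread (_◅_ {u} {v} uv s) here-c =
            spread s (around (dart v u _) (across (dart u v uv) (here-c _ refl)))

      -- In the second case every selected colour has a foreign one beside it, which is what gives
      -- it a boundary.
      ∑-atMostOne : ∀ (sel : Fin f → Bool) → ∑ (allFin f) (ι ∘ sel) ≤ 1 ⊎
                    (∀ c → T (sel c) → ∃[ c′ ] (T (sel c′) × c′ ≢ c))
      ∑-atMostOne sel with Finₚ.any? (λ c → T? (sel c) ×-dec ¬? (Finₚ.any? (λ c′ → T? (sel c′) ×-dec ¬? (c′ ≟ c))))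
      ... | no none = inj₂ another
        where
        another : ∀ c → T (sel c) → ∃[ c′ ] (T (sel c′) × c′ ≢ c)
        another c s with Finₚ.any? (λ c′ → T? (sel c′) ×-dec ¬? (c′ ≟ c))
        ... | yes found = found
        ... | no ¬found = contradiction (c , s , ¬found) none
      ... | yes (c , _ , alone) =
        inj₁ (ℕₚ.≤-trans (∑-mono (allFin f) (λ {x} _ → le x)) (ℕₚ.≤-reflexive (∑Fin-single c)))
        where
        le : ∀ x → ι (sel x) ≤ ι (does (x ≟ c))
        le x with sel x in eq | x ≟ c
        ... | false | _     = z≤n
        ... | true  | yes _ = ℕₚ.≤-refl
        ... | true  | no x≢ = contradiction (x , subst T (sym eq) tt , x≢) alone

      module _ (connected : Connected) (girth : GirthAtLeast G 6)
               (kept : Dart G → Bool) (glued : ∀ d → ¬ T (kept d) → a d ≡ a (rev G d))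
               (sel : Fin f → Bool) (hit : ∀ c → T (sel c) → ∃[ d ] (a d ≡ c)) where

        inClass? : ∀ c → U.Decidable (λ d → T (kept d) × c ≡ a d)
        inClass? c d = T? (kept d) ×-dec (c ≟ a d)

        -- The boundary of the class contains a directed cycle. Its darts have different colours on
        -- their two sides, so `glued` shows that they are kept.
        sixPerClass : ∀ c c′ → T (sel c) → T (sel c′) → c′ ≢ c → 6 ≤ ∑ darts (λ d → ι (does (inClass? c d)))
        sixPerClass c c′ s s′ c′≢c with hit c s | hit c′ s′
        ... | d , ad | d′ , ad′ with boundaryDart c connected d d′ ad (c′≢c ∘ trans (sym ad′))
        ... | e , be with boundaryCycle c girth be
        ... | ds , six , uds , bds = begin
          6                                            ≤⟨ six ⟩
          length ds                                    ≤⟨ ⊆⇒length≤ uds sub ⟩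
          length (filter (inClass? c) darts)           ≡⟨ ∑-filter (inClass? c) darts ⟩
          ∑ darts (λ d → ι (does (inClass? c d)))      ∎
          where
          open ℕₚ.≤-Reasoning
          sub : ∀ {x} → x ∈ ds → x ∈ filter (inClass? c) darts
          sub {x} x∈ with All.lookup bds x∈ | T? (kept x)
          ... | ax , arx | yes k = ∈-filter⁺ (inClass? c) (∈-darts x) (k , sym ax)
          ... | ax , arx | no ¬k = contradiction (trans (sym (glued x ¬k)) ax) arx

        -- Double counting of pairs of a selected colour and a kept dart of that colour: a colour
        -- has at least six darts, a dart only one colour.
        classBound : ∑ (allFin f) (ι ∘ sel) ≤ 1 ⊎ 6 * ∑ (allFin f) (ι ∘ sel) ≤ ∑ darts (ι ∘ kept)
        classBound with ∑-atMostOne sel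
        ... | inj₁ few = inj₁ few
        ... | inj₂ another = inj₂ (begin
          6 * ∑ (allFin f) (ι ∘ sel)                                        ≡⟨ ∑-*ˡ (allFin f) 6 (ι ∘ sel) ⟨
          ∑ (allFin f) (λ c → 6 * ι (sel c))                                ≤⟨ ∑-mono (allFin f) (λ {c} _ → six c) ⟩
          ∑ (allFin f) (λ c → ∑ darts (λ d → ι (does (inClass? c d))))      ≡⟨ ∑-swap (allFin f) darts _ ⟩
          ∑ darts (λ d → ∑ (allFin f) (λ c → ι (does (inClass? c d))))      ≤⟨ ∑-mono darts (λ {d} _ → once d) ⟩
          ∑ darts (ι ∘ kept)                                                ∎)
          where
          open ℕₚ.≤-Reasoning
          six : ∀ c → 6 * ι (sel c) ≤ ∑ darts (λ d → ι (does (inClass? c d)))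
          six c with sel c in eq
          ... | false = z≤n
          ... | true  with c′ , s′ , ≢ ← another c (subst T (sym eq) tt) =
            sixPerClass c c′ (subst T (sym eq) tt) s′ ≢
          once : ∀ d → ∑ (allFin f) (λ c → ι (does (inClass? c d))) ≤ ι (kept d)
          once d with kept d
          ... | true  = ℕₚ.≤-reflexive (∑Fin-single (a d))
          ... | false = ℕₚ.≤-reflexive (∑-zero (allFin f))

-- Sparsity of planar graphs of girth at least six

classes-≥ : ∀ {R : Rel A 0ℓ} {k} → HasClasses R k → ∀ {xs} → AllPairs (λ x y → ¬ R x y) xs → length xs ≤ k
classes-≥ (h , fibres) {xs} apart = ℕₚ.≤-trans (ℕₚ.≤-reflexive (sym (Listₚ.length-map (Surjection.to h) xs)))
  (unique⇒length≤ (AllPairsₚ.map⁺ (AllPairs.map (λ {x} {y} ¬R eq → ¬R (Equivalence.to (fibres x y) eq)) apart)))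

classes-≤ : ∀ {R : Rel A 0ℓ} {k} → HasClasses R k → (g : A → Fin m) → (∀ x y → g x ≡ g y → R x y) → k ≤ m
classes-≤ (h , fibres) g reflects = Finₚ.injective⇒≤ {f = g ∘ pick} λ {i} {j} eq →
  trans (sym (pick-to i)) (trans (Equivalence.from (fibres _ _) (reflects _ _ eq)) (pick-to j))
  where
  pick = λ i → proj₁ (Surjection.strictlySurjective h i)
  pick-to = λ i → proj₂ (Surjection.strictlySurjective h i)

module _ {n : ℕ} (G : Graph n) (planar : Planar G) (connected : Graph.Connected G) where
  open Graph G
  open Dart
  open Planar planar

  F : Dart G → Fin f
  F = Surjection.to (proj₁ faces)

  F-face : ∀ d → F (face d) ≡ F d
  F-face d = sym (Equivalence.from (proj₂ faces d (face d)) (fwd refl ◅ ε))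

  F-hit : ∀ c → ∃[ d ] F d ≡ c
  F-hit = Surjection.strictlySurjective (proj₁ faces)

  ends : Dart G → Fin n × Fin n
  ends d = src d , tgt d

  -- The dual edge of `d`. Union-find on these pairs merges the faces across deleted edges.
  sides : Dart G → Fin f × Fin f
  sides d = F d , F (rev G d)

  Listed : List (Dart G) → Dart G → Set
  Listed L d = d ∈ L ⊎ rev G d ∈ L

  ends-joined : ∀ L {d} → Listed L d → label (map ends L) (src d) ≡ label (map ends L) (tgt d)
  ends-joined L (inj₁ d∈) = label-joins (map ends L) (∈-map⁺ ends d∈)
  ends-joined L (inj₂ d∈) = sym (label-joins (map ends L) (∈-map⁺ ends d∈))

  faceClass : List (Dart G) → Dart G → Fin f
  faceClass L d = label (map sides L) (F d)

  sides-joined : ∀ L {d} → Listed L d → faceClass L d ≡ faceClass L (rev G d)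
  sides-joined L (inj₁ d∈) = label-joins (map sides L) (∈-map⁺ sides d∈)
  sides-joined L {d} (inj₂ d∈) = sym (trans (label-joins (map sides L) (∈-map⁺ sides d∈))
    (cong (faceClass L) (rev-rev G d)))

  -- Euler's formula, with `length E ≤ e`, `v ≤ n`, and `1 ≤ c` witnessed by `d₀`. Connectedness
  -- leaves a single class of vertices, so `n` is at most one more than the rank.
  eulerBound : ∀ {E} → Dart G → Unique E → All (Ascending G) E → (∀ d → Listed E d) →
               length E < rank (map ends E) + f
  eulerBound {E} d₀ uE ascE listed = ℕₚ.≤-pred (begin
    2 + length E                              ≡⟨ ℕₚ.+-comm 2 _ ⟩
    length E + 2                              ≤⟨ ℕₚ.+-mono-≤ (classes-≥ edges (apart uE ascE)) (ℕₚ.*-monoʳ-≤ 2 1≤c) ⟩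
    e + 2 * c                                 ≡⟨ euler ⟨
    v + f                                     ≤⟨ ℕₚ.+-monoˡ-≤ f (classes-≤ vertices src (λ _ _ eq → eq)) ⟩
    n + f                                     ≡⟨ cong (_+ f) (rank+roots (map ends E)) ⟨
    rank (map ends E) + roots (map ends E) + f
      ≤⟨ ℕₚ.+-monoˡ-≤ f (ℕₚ.+-monoʳ-≤ (rank (map ends E)) (roots-≤1 (map ends E) _ same)) ⟩
    rank (map ends E) + 1 + f                 ≡⟨ cong (_+ f) (ℕₚ.+-comm (rank (map ends E)) 1) ⟩
    suc (rank (map ends E) + f)               ∎)
    where
    open ℕₚ.≤-Reasoning
    apart : ∀ {L} → Unique L → All (Ascending G) L → AllPairs (λ d d′ → ¬ (d ≡ d′ ⊎ rev G d ≡ d′)) L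
    apart []       []         = []
    apart (∉ ∷ u) (asc ∷ as) = All.zipWith
      (λ { (≢ , asc′) (inj₁ eq) → ≢ eq
         ; (≢ , asc′) (inj₂ refl) → ℕₚ.<-asym asc asc′ }) (∉ , as) ∷ apart u as
    1≤c : 1 ≤ c
    1≤c = classes-≥ components {xs = d₀ ∷ []} ([] ∷ [])
    joined : ∀ {x y} → Star Adj x y → label (map ends E) x ≡ label (map ends E) y
    joined ε       = refl
    joined (a ◅ s) = trans (ends-joined E (listed (dart _ _ a))) (joined s)
    same : ∀ z → label (map ends E) z ≡ label (map ends E) (src d₀)
    same z = joined (connected z (src d₀))

  -- The cycle rank of the remaining edges H is less than the number of face
  -- classes left by the deleted edges K, in a form without subtraction.
  record Split (K H : List (Dart G)) : Set where
    field
      cover : ∀ d → Listed K d ⊎ Listed H d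
      bound : length H + suc (rank (map sides K)) ≤ rank (map ends H) + f

  deleteEdge : ∀ {K d H} → Split K (d ∷ H) → Split (d ∷ K) H
  deleteEdge {K} {d} {H} S = record { cover = cover′ ; bound = bound′ bound }
    where
    open Split S
    cover′ : ∀ d′ → Listed (d ∷ K) d′ ⊎ Listed H d′
    cover′ d′ with cover d′
    ... | inj₁ (inj₁ ∈K)           = inj₁ (inj₁ (there ∈K))
    ... | inj₁ (inj₂ ∈K)           = inj₁ (inj₂ (there ∈K))
    ... | inj₂ (inj₁ (here refl))  = inj₁ (inj₁ (here refl))
    ... | inj₂ (inj₁ (there ∈H))   = inj₂ (inj₁ ∈H)
    ... | inj₂ (inj₂ (here refl))  = inj₁ (inj₂ (here refl))
    ... | inj₂ (inj₂ (there ∈H))   = inj₂ (inj₂ ∈H)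
    U : Fin n → Fin n
    U = label (map ends H)
    -- Deleted edges have merged sides and the edges of `H` have joined ends, so `d` alone can
    -- violate both, as `jordan` requires.
    only : ∀ d′ → (d′ ≡ d ⊎ d′ ≡ rev G d) ⊎ (faceClass K d′ ≡ faceClass K (rev G d′) ⊎ U (src d′) ≡ U (tgt d′))
    only d′ with cover d′
    ... | inj₁ ∈K                   = inj₂ (inj₁ (sides-joined K ∈K))
    ... | inj₂ (inj₁ (here eq))     = inj₁ (inj₁ eq)
    ... | inj₂ (inj₁ (there ∈H))    = inj₂ (inj₂ (ends-joined H (inj₁ ∈H)))
    ... | inj₂ (inj₂ (here eq))     = inj₁ (inj₂ (trans (sym (rev-rev G d′)) (cong (rev G) eq)))
    ... | inj₂ (inj₂ (there ∈H))    = inj₂ (inj₂ (ends-joined H (inj₂ ∈H)))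
    rK = rank (map sides K)
    bound′ : suc (length H) + suc rK ≤ rank (map ends (d ∷ H)) + f →
             length H + suc (rank (map sides (d ∷ K))) ≤ rank (map ends H) + f
    bound′ le with U (src d) ≟ U (tgt d)
    -- Not a bridge: the rank of the edges stays, their number falls by one, and this pays for at
    -- most one merging of face classes.
    ... | yes _  = begin
      length H + suc (rank (map sides (d ∷ K)))   ≤⟨ ℕₚ.+-monoʳ-≤ (length H) (s≤s (rank-∷-≤ (map sides K) (sides d))) ⟩
      length H + suc (suc rK)                     ≡⟨ ℕₚ.+-suc (length H) (suc rK) ⟩
      suc (length H) + suc rK                     ≤⟨ le ⟩
      rank (map ends H) + f                       ∎
      where open ℕₚ.≤-Reasoning
    -- A bridge: rank and number of edges both fall by one, and by `jordan` the two sides are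
    -- already in one face class.
    ... | no U≢
      rewrite dec-true (faceClass K d ≟ faceClass K (rev G d))
                (jordan G embedding (faceClass K) (λ x → cong (label (map sides K)) (F-face x)) U d only U≢) =
      ℕₚ.≤-pred le

  deleteEdges : ∀ D {K H} → Split K (D ++ H) → ∃[ K′ ] Split K′ H
  deleteEdges []      S = _ , S
  deleteEdges (d ∷ D) S = deleteEdges D (deleteEdge S)

  module _ (girth : GirthAtLeast G 6) where

    -- With `h` edges in `K`, `w` vertices in `W` and `q` face classes left, the cycle rank bound
    -- gives `h + 2 ≤ w + q`. Eliminate `q` by `classBound`.
    sparse : ∀ (K : Graph n) → _⊆ᴳ_ G K G → (W : Fin n → Bool) → ∀ {w₀} → T (W w₀) →
             (∀ {u v} → Graph.Adj K u v → T (W u)) →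
             degreeSum G K + 3 ≤ 3 * ∑ (allFin n) (ι ∘ W)
    sparse K sub W {w₀} w₀∈ inside with darts G in darts≡
    -- Without darts there is no witness for `1 ≤ c`. Here the degree sum is zero, and `w₀` makes
    -- the right side at least 3.
    ... | [] = begin
      degreeSum G K + 3 ≡⟨ cong (_+ 3) (trans (handshake G K sub) (cong (λ ds → ∑ ds _) darts≡)) ⟩
      3                 ≤⟨ ℕₚ.*-monoʳ-≤ 3 (rank<support [] W w₀∈ (λ ())) ⟩
      3 * ∑ (allFin n) (ι ∘ W) ∎
      where open ℕₚ.≤-Reasoning
    ... | d₀ ∷ _ = final (proj₂ split) (classBound G embedding (faceClass K′) (λ x → cong (label (map sides K′)) (F-face x))
                            connected girth inK glued sel hit)
      where
      inK : Dart G → Bool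
      inK d = Graph.adj K (src d) (tgt d)
      keep? : U.Decidable (λ d → Ascending G d × T (inK d))
      keep? d = ascending? G d ×-dec T? (inK d)
      drop? : U.Decidable (λ d → Ascending G d × ¬ T (inK d))
      drop? d = ascending? G d ×-dec ¬? (T? (inK d))
      -- Each edge of `G` is represented once, by its ascending dart: in `D` if it is to be deleted,
      -- in `H` if it belongs to `K`.
      D H : List (Dart G)
      D = filter drop? (darts G)
      H = filter keep? (darts G)
      listedAsc : ∀ d → Ascending G d → d ∈ D ++ H
      listedAsc d asc with T? (inK d)
      ... | yes k = ∈-++⁺ʳ D (∈-filter⁺ keep? (∈-darts G d) (asc , k))
      ... | no ¬k = ∈-++⁺ˡ (∈-filter⁺ drop? (∈-darts G d) (asc , ¬k))
      listed : ∀ d → Listed (D ++ H) d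
      listed d with ascending⊎ G d
      ... | inj₁ asc = inj₁ (listedAsc d asc)
      ... | inj₂ asc = inj₂ (listedAsc (rev G d) asc)
      unique : Unique (D ++ H)
      unique = Uniqueₚ.++⁺ (Uniqueₚ.filter⁺ drop? (darts-unique G)) (Uniqueₚ.filter⁺ keep? (darts-unique G))
        λ (∈D , ∈H) → proj₂ (proj₂ (∈-filter⁻ drop? {xs = darts G} ∈D)) (proj₂ (proj₂ (∈-filter⁻ keep? {xs = darts G} ∈H)))
      ascending : All (Ascending G) (D ++ H)
      ascending = Allₚ.++⁺ (All.map proj₁ (Allₚ.all-filter drop? (darts G))) (All.map proj₁ (Allₚ.all-filter keep? (darts G)))
      start : Split [] (D ++ H)
      start = record { cover = inj₂ ∘ listed
                     ; bound = ℕₚ.≤-trans (ℕₚ.≤-reflexive (ℕₚ.+-comm _ 1)) (eulerBound d₀ unique ascending listed) }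
      split : ∃[ K′ ] Split K′ H
      split = deleteEdges D start
      K′ = proj₁ split
      symK : ∀ d → inK (rev G d) ≡ inK d
      symK d = Graph.adj-sym K _ _
      ∈H⁻ : ∀ {d} → d ∈ H → T (inK d)
      ∈H⁻ d∈ = proj₂ (proj₂ (∈-filter⁻ keep? {xs = darts G} d∈))
      glued : ∀ d → ¬ T (inK d) → faceClass K′ d ≡ faceClass K′ (rev G d)
      glued d ¬k with Split.cover (proj₂ split) d
      ... | inj₁ ∈K         = sides-joined K′ ∈K
      ... | inj₂ (inj₁ d∈)  = contradiction (∈H⁻ d∈) ¬k
      ... | inj₂ (inj₂ d∈)  = contradiction (subst T (symK d) (∈H⁻ d∈)) ¬k
      sel : Fin f → Bool
      sel c = does (root? (map sides K′) c)
      hit : ∀ c → T (sel c) → ∃[ d ] (faceClass K′ d ≡ c)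
      hit c s with F-hit c | root? (map sides K′) c
      ... | d , refl | yes r = d , r
      degreeSum≡ : degreeSum G K ≡ 2 * length H
      degreeSum≡ = trans (handshake G K sub) (trans (∑-ascending G inK symK)
        (cong (2 *_) (sym (∑-filter keep? (darts G)))))
      w = ∑ (allFin n) (ι ∘ W)
      rank<w : rank (map ends H) < w
      rank<w = rank<support (map ends H) W w₀∈ λ p∈ → case ∈-map⁻ ends p∈ of λ
        { (d , d∈ , refl) → inside (∈H⁻ d∈) , inside (subst T (sym (symK d)) (∈H⁻ d∈)) }
      final : Split K′ H → roots (map sides K′) ≤ 1 ⊎ 6 * roots (map sides K′) ≤ ∑ (darts G) (ι ∘ inK) →
              degreeSum G K + 3 ≤ 3 * w
      final S alt = subst (λ k → k + 3 ≤ 3 * w) (sym degreeSum≡) (combine alt)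
        where
        open ℕₚ.≤-Reasoning
        open +-*-Solver
        h = length H
        r = rank (map sides K′)
        q = roots (map sides K′)
        rV = rank (map ends H)
        -- The 2 collects one unit from `Split.bound` and one from `rank<w`; then `r + q` replaces
        -- `f` and `r` cancels.
        key : h + 2 ≤ w + q
        key = ℕₚ.+-cancelʳ-≤ r _ _ (begin
          h + 2 + r         ≡⟨ solve 2 (λ h r → h :+ con 2 :+ r := con 1 :+ (h :+ (con 1 :+ r))) refl h r ⟩
          suc (h + suc r)   ≤⟨ s≤s (Split.bound S) ⟩
          suc (rV + f)      ≡⟨ cong (λ k → suc (rV + k)) (rank+roots (map sides K′)) ⟨
          suc rV + (r + q)  ≤⟨ ℕₚ.+-monoˡ-≤ (r + q) rank<w ⟩
          w + (r + q)       ≡⟨ solve 3 (λ w r q → w :+ (r :+ q) := w :+ q :+ r) refl w r q ⟩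
          w + q + r         ∎)
        combine : q ≤ 1 ⊎ 6 * q ≤ ∑ (darts G) (ι ∘ inK) → 2 * h + 3 ≤ 3 * w
        -- Now `h + 1 ≤ w`. This case fixes the constant 3, attained by `h = 0` and `w = 1`; the
        -- other case has 3 to spare.
        combine (inj₁ q≤1) = begin
          2 * h + 3         ≤⟨ ℕₚ.+-monoˡ-≤ 3 (ℕₚ.*-monoˡ-≤ h (ℕₚ.n≤1+n 2)) ⟩
          3 * h + 3         ≡⟨ solve 1 (λ h → con 3 :* h :+ con 3 := con 3 :* (h :+ con 1)) refl h ⟩
          3 * (h + 1)       ≤⟨ ℕₚ.*-monoʳ-≤ 3 (ℕₚ.+-cancelʳ-≤ 1 _ _ (begin
            h + 1 + 1         ≡⟨ ℕₚ.+-assoc h 1 1 ⟩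
            h + 2             ≤⟨ key ⟩
            w + q             ≤⟨ ℕₚ.+-monoʳ-≤ w q≤1 ⟩
            w + 1             ∎)) ⟩
          3 * w             ∎
        combine (inj₂ 6q≤) = ℕₚ.+-cancelʳ-≤ (h + 3) _ _ (begin
          2 * h + 3 + (h + 3)   ≡⟨ solve 1 (λ h → con 2 :* h :+ con 3 :+ (h :+ con 3) := con 3 :* (h :+ con 2)) refl h ⟩
          3 * (h + 2)           ≤⟨ ℕₚ.*-monoʳ-≤ 3 key ⟩
          3 * (w + q)           ≡⟨ ℕₚ.*-distribˡ-+ 3 w q ⟩
          3 * w + 3 * q         ≤⟨ ℕₚ.+-monoʳ-≤ (3 * w) 3q≤h ⟩
          3 * w + h             ≤⟨ ℕₚ.+-monoʳ-≤ (3 * w) (ℕₚ.m≤m+n h 3) ⟩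
          3 * w + (h + 3)       ∎)
          where
          3q≤h : 3 * q ≤ h
          3q≤h = ℕₚ.*-cancelˡ-≤ 2 (begin
            2 * (3 * q)         ≡⟨ ℕₚ.*-assoc 2 3 q ⟨
            6 * q               ≤⟨ 6q≤ ⟩
            ∑ (darts G) (ι ∘ inK) ≡⟨ handshake G K sub ⟨
            degreeSum G K       ≡⟨ degreeSum≡ ⟩
            2 * h               ∎)

-- Paths through vertices of degree at most two

steps-++ʳ : ∀ (xs : List (Fin n)) {ys e} → e ∈ steps ys → e ∈ steps (xs ++ ys)
steps-++ʳ []            e∈ = e∈
steps-++ʳ (x ∷ [])      {y ∷ ys} e∈ = there e∈
steps-++ʳ (x ∷ x′ ∷ xs) e∈ = there (steps-++ʳ (x′ ∷ xs) e∈)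

module _ {n : ℕ} (H : Graph n) where
  open Graph H

  data Walk : Fin n → Fin n → List (Fin n) → Set where
    stop : ∀ {v} → Walk v v [ v ]
    _⟶_  : ∀ {u v w p} → Adj u v → Walk v w p → Walk u w (u ∷ p)

  infixr 5 _⟶_

  private
    variable
      s t u v w : Fin n
      p q : List (Fin n)

  Walk⇒Linked : Walk s t p → Linked Adj p
  Walk⇒Linked stop                = [-]
  Walk⇒Linked (a ⟶ stop)          = a ∷ [-]
  Walk⇒Linked (a ⟶ w@(_ ⟶ _))     = a ∷ Walk⇒Linked w

  Walk-length : Walk s t p → 1 ≤ length p
  Walk-length stop    = s≤s z≤n
  Walk-length (_ ⟶ _) = s≤s z≤n

  Walk-∈-target : Walk s t p → t ∈ p
  Walk-∈-target stop    = here refl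
  Walk-∈-target (_ ⟶ w) = there (Walk-∈-target w)

  Walk-head : Walk s t (v ∷ p) → s ≡ v
  Walk-head stop    = refl
  Walk-head (_ ⟶ _) = refl

  Walk-++ : Walk s t p → Adj t u → Walk u v q → Walk s v (p ++ q)
  Walk-++ stop    a w′ = a ⟶ w′
  Walk-++ (b ⟶ w) a w′ = b ⟶ Walk-++ w a w′

  Walk-reverse : Walk s t p → Walk t s (reverse p)
  Walk-reverse stop = stop
  Walk-reverse (_⟶_ {u = x} {p = p} a w) =
    subst (Walk _ _) (sym (Listₚ.unfold-reverse x p)) (Walk-++ (Walk-reverse w) (Adj-sym H a) stop)

  Walk-suffix : ∀ p {q} → Walk s t (p ++ v ∷ q) → Walk v t (v ∷ q)
  Walk-suffix []       stop      = stop
  Walk-suffix []       (a ⟶ w)   = a ⟶ w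
  Walk-suffix (_ ∷ []) (a ⟶ w)   = Walk-suffix [] w
  Walk-suffix (_ ∷ p@(_ ∷ _)) (a ⟶ w) = Walk-suffix p w

  Walk-prefix : ∀ p {q} → Walk s t (p ++ v ∷ q) → Walk s v (p ++ [ v ])
  Walk-prefix []       stop      = stop
  Walk-prefix []       (a ⟶ w)   = stop
  Walk-prefix (_ ∷ []) (a ⟶ w)   = a ⟶ Walk-prefix [] w
  Walk-prefix (_ ∷ p@(_ ∷ _)) (a ⟶ w) = a ⟶ Walk-prefix p w

  -- Loop erasure: if `s` recurs later, everything before its recurrence is dropped.
  Star⇒Walk : Star Adj s t → ∃[ p ] (Walk s t p × Unique p)
  Star⇒Walk {s} ε = [ s ] , stop , [] ∷ []
  Star⇒Walk {s} (a ◅ as) with Star⇒Walk as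
  ... | p , w , u with Any.any? (s ≟_) p
  ...   | no s∉ = s ∷ p , a ⟶ w , Allₚ.¬Any⇒All¬ p s∉ ∷ u
  ...   | yes s∈ with ∈-∃++ s∈
  ...     | p₁ , p₂ , refl = s ∷ p₂ , Walk-suffix p₁ w , Unique-suffix p₁ u

  lastEdge : Adj s v → Walk v t p → ∃[ X ] ∃[ q ] (s ∷ p ≡ X ++ q ∷ t ∷ [] × Adj q t)
  lastEdge {s} a stop    = [] , s , refl , a
  lastEdge {s} a (b ⟶ w) with X , q , eq , c ← lastEdge b w = s ∷ X , q , cong (s ∷_) eq , c

  -- The vertices `q` and `w` may coincide; this is how a vertex of degree one is described.
  NeighboursIn : Fin n → Fin n → Fin n → Set
  NeighboursIn v q w = ∀ u → Adj v u → u ≡ q ⊎ u ≡ w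

  neighbours : degree v ≤ 2 → Adj v u → ∃[ w ] (Adj v w × NeighboursIn v u w)
  neighbours {v} {u} d≤2 a
    with Finₚ.any? (λ w → Adj? v w ×-dec ¬? (w ≟ u))
  ... | no none = u , a , λ x b → case x ≟ u of λ
          { (yes eq) → inj₁ eq ; (no ≢) → contradiction (x , b , ≢) none }
  ... | yes (w , b , w≢u) = w , b , only
    where
    only : NeighboursIn v u w
    only x c with x ≟ u | x ≟ w
    ... | yes e | _     = inj₁ e
    ... | no _  | yes e = inj₂ e
    ... | no x≢u | no x≢w = contradiction (ℕₚ.≤-trans three d≤2) λ { (s≤s (s≤s ())) }
      where
      three : 3 ≤ degree v
      three = ⊆⇒length≤ {xs = x ∷ w ∷ u ∷ []} ((x≢w ∷ x≢u ∷ []) ∷ (w≢u ∷ []) ∷ [] ∷ [])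
        λ { (here refl) → ∈-filter⁺ (Adj? v) (∈-allFin _) c
          ; (there (here refl)) → ∈-filter⁺ (Adj? v) (∈-allFin _) b
          ; (there (there (here refl))) → ∈-filter⁺ (Adj? v) (∈-allFin _) a }

  -- Removing the edges of such a `p` isolates `v`.
  UsesAll : List (Fin n) → Fin n → Set
  UsesAll p v = ∀ u → Adj v u → Traverses p v u

  UsesAll-++ʳ : ∀ p {q} → UsesAll q v → UsesAll (p ++ q) v
  UsesAll-++ʳ p use u a with use u a
  ... | inj₁ e = inj₁ (steps-++ʳ p e)
  ... | inj₂ e = inj₂ (steps-++ʳ p e)

  -- The two shapes of a walk from `s` that uses every edge at `v` near its end: `v` is last and has
  -- one neighbour, or `v` is last but one and lies between its neighbours.
  data Absorbed (s v : Fin n) : List (Fin n) → Set where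
    atEnd   : ∀ X q → Walk s v (X ++ q ∷ v ∷ []) → NeighboursIn v q q → Absorbed s v (X ++ q ∷ v ∷ [])
    pastEnd : ∀ X q w → Walk s w (X ++ q ∷ v ∷ w ∷ []) → NeighboursIn v q w → Absorbed s v (X ++ q ∷ v ∷ w ∷ [])

  Absorbed⇒Walk : Absorbed s v p → ∃[ t ] Walk s t p
  Absorbed⇒Walk (atEnd X q w _)      = _ , w
  Absorbed⇒Walk (pastEnd X q _ w _)  = _ , w

  Absorbed⇒UsesAll : Absorbed s v p → UsesAll p v
  Absorbed⇒UsesAll {v = v} (atEnd X q _ N) = UsesAll-++ʳ X use
    where
    use : UsesAll (q ∷ v ∷ []) v
    use u a with N u a
    ... | inj₁ refl = inj₂ (here refl)
    ... | inj₂ refl = inj₂ (here refl)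
  Absorbed⇒UsesAll {v = v} (pastEnd X q w _ N) = UsesAll-++ʳ X use
    where
    use : UsesAll (q ∷ v ∷ w ∷ []) v
    use u a with N u a
    ... | inj₁ refl = inj₂ (here refl)
    ... | inj₂ refl = inj₁ (there (here refl))

  -- If the second neighbour w of the last vertex v is already on the path, then
  -- the path goes from w directly to v and from there back to v's predecessor.
  absorbLast : ∀ X q → Walk s v (X ++ q ∷ v ∷ []) → Unique (X ++ q ∷ v ∷ []) → Adj q v → degree v ≤ 2 →
               ∃[ r ] (Absorbed s v r × Unique r × (∀ {x} → x ∈ r → x ∈ X ++ q ∷ v ∷ [] ⊎ Adj v x))
  absorbLast {s} {v} X q W U a d≤2 with neighbours d≤2 (Adj-sym H a)
  ... | w , b , N with w ≟ q
  ...   | yes refl = _ , atEnd X q W N , U , inj₁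
  ...   | no w≢q with Any.any? (w ≟_) (X ++ q ∷ v ∷ [])
  ...     | no w∉ = X ++ q ∷ v ∷ w ∷ []
      , pastEnd X q w (subst (Walk s w) assoc (Walk-++ W b stop)) N
      , subst Unique assoc (unique-↭ (↭ₚ.∷↭∷ʳ w _) (Allₚ.¬Any⇒All¬ _ w∉ ∷ U))
      , λ {x} x∈ → case ∈-++⁻ (X ++ q ∷ v ∷ []) (subst (x ∈_) (sym assoc) x∈) of λ
          { (inj₁ p) → inj₁ p ; (inj₂ (here refl)) → inj₂ b }
    where
    assoc : (X ++ q ∷ v ∷ []) ++ [ w ] ≡ X ++ q ∷ v ∷ w ∷ []
    assoc = Listₚ.++-assoc X _ _
  ...     | yes w∈ with ∈-++⁻ X w∈
  ...       | inj₂ (here e)         = contradiction e w≢q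
  ...       | inj₂ (there (here refl)) = ⊥-elim (¬Adj-self H b)
  ...       | inj₁ w∈X with ∈-∃++ w∈X
  ...         | X₁ , X₂ , refl = X₁ ++ w ∷ v ∷ q ∷ []
      , pastEnd X₁ w q W′ (λ u c → [ inj₂ , inj₁ ]′ (N u c))
      , unique-prefix
      , λ x∈ → inj₁ (sub x∈)
    where
    assoc : (X₁ ++ w ∷ X₂) ++ q ∷ v ∷ [] ≡ X₁ ++ w ∷ (X₂ ++ q ∷ v ∷ [])
    assoc = Listₚ.++-assoc X₁ _ _
    W′ : Walk s q (X₁ ++ w ∷ v ∷ q ∷ [])
    W′ = subst (Walk s q) (Listₚ.++-assoc X₁ _ _)
           (Walk-++ (Walk-prefix X₁ (subst (Walk s v) assoc W)) (Adj-sym H b) (Adj-sym H a ⟶ stop))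
    -- Up to order, the new path is the old one without the stretch `X₂` between `w` and `q`, so its
    -- vertices remain distinct.
    shuffle : (X₁ ++ w ∷ X₂) ++ q ∷ v ∷ [] ↭ X₂ ++ (X₁ ++ w ∷ v ∷ q ∷ [])
    shuffle = begin
      (X₁ ++ w ∷ X₂) ++ q ∷ v ∷ []        ↭⟨ ↭ₚ.++⁺ˡ (X₁ ++ w ∷ X₂) (_↭_.swap q v ↭-refl) ⟩
      (X₁ ++ w ∷ X₂) ++ v ∷ q ∷ []        ≡⟨ Listₚ.++-assoc X₁ _ _ ⟩
      X₁ ++ [ w ] ++ X₂ ++ v ∷ q ∷ []     ≡⟨ Listₚ.++-assoc X₁ [ w ] _ ⟨
      (X₁ ++ [ w ]) ++ X₂ ++ v ∷ q ∷ []   ↭⟨ ↭ₚ.shifts (X₁ ++ [ w ]) X₂ ⟩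
      X₂ ++ (X₁ ++ [ w ]) ++ v ∷ q ∷ []   ≡⟨ cong (X₂ ++_) (Listₚ.++-assoc X₁ [ w ] _) ⟩
      X₂ ++ X₁ ++ w ∷ v ∷ q ∷ []          ∎
      where open PermutationReasoning
    sub : ∀ {x} → x ∈ X₁ ++ w ∷ v ∷ q ∷ [] → x ∈ (X₁ ++ w ∷ X₂) ++ q ∷ v ∷ []
    sub x∈ = ↭ₚ.∈-resp-↭ (↭-sym shuffle) (∈-++⁺ʳ X₂ x∈)
    unique-prefix : Unique (X₁ ++ w ∷ v ∷ q ∷ [])
    unique-prefix = Unique-suffix X₂ (unique-↭ shuffle U)

  -- Only the far end changes. Any new vertex is a neighbour of `v`, which later tells how the new
  -- end can meet vertices placed in front of `s`.
  absorb : Walk s v p → Unique p → s ≢ v → degree v ≤ 2 →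
           ∃[ q ] (Absorbed s v q × Unique q × (∀ {x} → x ∈ q → x ∈ p ⊎ Adj v x))
  absorb stop         _ s≢v _   = contradiction refl s≢v
  absorb W@(e ⟶ W₁) U s≢v d≤2 with lastEdge e W₁
  ... | X , q , eq , a with absorbLast X q (subst (Walk _ _) eq W) (subst Unique eq U) a d≤2
  ...   | r , A , Ur , sub = r , A , Ur , λ x∈ → [ inj₁ ∘ subst (_ ∈_) (sym eq) , inj₂ ]′ (sub x∈)

  Absorbed-∈ : Absorbed s v p → v ∈ p
  Absorbed-∈ (atEnd X q _ _)     = ∈-++⁺ʳ X (there (here refl))
  Absorbed-∈ (pastEnd X q _ _ _) = ∈-++⁺ʳ X (there (here refl))

  -- Isolating two vertices by one path

  PathThrough : Fin n → Fin n → Set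
  PathThrough a b = ∃[ s ] ∃[ t ] ∃[ p ] (Walk s t p × Unique p × UsesAll p a × UsesAll p b)

  -- Absorbing `b` keeps the start `a`. The path contains `b` as well, so it has a first step, and
  -- this is the only edge at `a`.
  throughLeaf : ∀ {a b} → Walk a b p → Unique p → NeighboursIn a u u → a ≢ b → degree b ≤ 2 → PathThrough a b
  throughLeaf {a = a} {b} W U N a≢b d≤2 with absorb W U a≢b d≤2
  ... | r , A , Ur , _ = _ , _ , r , W′ , Ur , use W′ (Absorbed-∈ A) , Absorbed⇒UsesAll A
    where
    W′ = proj₂ (Absorbed⇒Walk A)
    use₁ : ∀ {c p} → Adj a c → (a , c) ∈ steps p → UsesAll p a
    use₁ e s u f with N _ e | N u f
    ... | inj₁ refl | inj₁ refl = inj₁ s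
    ... | inj₁ refl | inj₂ refl = inj₁ s
    ... | inj₂ refl | inj₁ refl = inj₁ s
    ... | inj₂ refl | inj₂ refl = inj₁ s
    use : ∀ {t p} → Walk a t p → b ∈ p → UsesAll p a
    use stop            (here e) = contradiction (sym e) a≢b
    use {p = p} (e ⟶ stop) _   = use₁ {p = p} e (here refl)
    use (_⟶_ {p = p} e (_ ⟶ _)) _ = use₁ {p = a ∷ p} e (here refl)

  UsesAll-interior : ∀ {h a c} p → NeighboursIn a h c → UsesAll (h ∷ a ∷ c ∷ p) a
  UsesAll-interior _ N u e with N u e
  ... | inj₁ refl = inj₂ (here refl)
  ... | inj₂ refl = inj₁ (there (here refl))

  UsesAll-interior′ : ∀ {h a c t p} → NeighboursIn a h c → Walk c t p → UsesAll (h ∷ a ∷ p) a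
  UsesAll-interior′ N stop    = UsesAll-interior [] N
  UsesAll-interior′ {p = _ ∷ p} N (_ ⟶ _) = UsesAll-interior p N

  module _ (girth : GirthAtLeast H 6) where

    -- Both a and b lie on a cycle of length at least 6, which therefore has an
    -- edge c d with neither a nor b as an endpoint; p runs from d to b.
    throughCycle : ∀ {h a b c p} → Adj h a → Adj a c → NeighboursIn a h c → Walk c b (c ∷ p) → Unique (h ∷ a ∷ c ∷ p) →
                   Adj b h → degree b ≤ 2 → PathThrough a b
    throughCycle {h} {a} {b} {c} {p} ha ac N W U bh d≤2
      with girth h (a ∷ c ∷ p) record
             { atLeast3 = s≤s (s≤s z≤n) ; distinct = U
             ; closed = Walk⇒Linked (Walk-++ (ha ⟶ ac ⟶ W) bh stop) }
    -- Cycles of length 3 and 4 are ruled out by the girth. What remains has at least one vertex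
    -- between `d` and the end of the path, so `c d` avoids `b`.
    throughCycle _ _ _ stop       _ _ _ | s≤s (s≤s (s≤s ()))
    throughCycle _ _ _ (_ ⟶ stop) _ _ _ | s≤s (s≤s (s≤s (s≤s ())))
    throughCycle {h} {a} {b} {c} {d ∷ p@(_ ∷ _)} ha ac N (_⟶_ {v = d} cd (e ⟶ W)) U bh d≤2 | _
      with lastEdge e W | neighbours d≤2 bh
    ... | X , y , eq , yb | w , _ , Nb =
      d , c , (d ∷ p) ++ h ∷ a ∷ c ∷ []
        , Walk-++ (e ⟶ W) bh (ha ⟶ ac ⟶ stop)
        , U′
        , UsesAll-++ʳ (d ∷ p) (UsesAll-interior [] N)
        , subst (λ l → UsesAll l b) eq′ (UsesAll-++ʳ X use)
      where
      eq′ : X ++ y ∷ b ∷ h ∷ a ∷ c ∷ [] ≡ (d ∷ p) ++ h ∷ a ∷ c ∷ []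
      eq′ = trans (sym (Listₚ.++-assoc X _ _)) (cong (_++ h ∷ a ∷ c ∷ []) (sym eq))
      U′ : Unique ((d ∷ p) ++ h ∷ a ∷ c ∷ [])
      U′ = unique-↭ (↭ₚ.++-comm (h ∷ a ∷ c ∷ []) (d ∷ p)) U
      -- The predecessor `y` of `b` and its successor `h` are thus two different neighbours, and `b`
      -- has no others.
      y≢h : y ≢ h
      y≢h refl = All.lookup (AllPairs.head U) (there (there (subst (h ∈_) (sym eq) (∈-++⁺ʳ X (here refl))))) refl
      use : UsesAll (y ∷ b ∷ h ∷ a ∷ c ∷ []) b
      use u f with Nb u f | Nb y (Adj-sym H yb)
      ... | inj₁ refl | _         = inj₁ (there (here refl))
      ... | inj₂ refl | inj₁ y≡h  = contradiction y≡h y≢h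
      ... | inj₂ refl | inj₂ refl = inj₂ (here refl)

    -- Absorb `b` on the part from `c` on, then put `h` and `a` back in front. The vertex `a` cannot
    -- be met, since `b` is neither of its neighbours; meeting `h` means that `b` is adjacent to
    -- `h`, which closes a cycle.
    throughInterior : ∀ {h a b c p} → Adj h a → Adj a c → NeighboursIn a h c → Walk c b (c ∷ p) →
                      Unique (h ∷ a ∷ c ∷ p) → degree b ≤ 2 → PathThrough a b
    throughInterior {h} {a} {b} {c} {p} ha ac N W U@((_ ∷ h∉) ∷ a∉ ∷ U₁) d≤2 with c ≟ b
    ... | no c≢b with absorb W U₁ c≢b d≤2
    ...   | r , A , Ur , sub with Any.any? (h ≟_) r
    ...     | yes h∈r = throughCycle ha ac N W U bh d≤2
      where
      bh : Adj b h
      bh with sub h∈r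
      ... | inj₁ h∈ = contradiction refl (All.lookup h∉ h∈)
      ... | inj₂ e  = e
    ...     | no h∉r = _ , _ , h ∷ a ∷ r , ha ⟶ ac ⟶ W′
                     , ((λ { refl → ¬Adj-self H ha }) ∷ Allₚ.¬Any⇒All¬ r h∉r) ∷ Allₚ.¬Any⇒All¬ r a∉r ∷ Ur
                     , UsesAll-interior′ N W′
                     , UsesAll-++ʳ (h ∷ a ∷ []) (Absorbed⇒UsesAll A)
      where
      W′ = proj₂ (Absorbed⇒Walk A)
      a∉r : a ∉ r
      a∉r a∈r with sub a∈r
      ... | inj₁ a∈ = contradiction refl (All.lookup a∉ a∈)
      ... | inj₂ ba with N b (Adj-sym H ba)
      ...   | inj₁ refl = contradiction refl (All.lookup h∉ (Walk-∈-target W))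
      ...   | inj₂ refl = c≢b refl
    -- When `c` is `b` there is nothing to absorb along. Either `b` is a leaf, or its other
    -- neighbour `w` prolongs the path; `w` equal to `h` would give a triangle.
    throughInterior {h} {a} {b} {c} {p} ha ac N W U@((h≢a ∷ h∉) ∷ a∉ ∷ U₁) d≤2 | yes refl
      with neighbours d≤2 (Adj-sym H ac)
    ... | w , bw , Nb with w ≟ a | w ≟ h
    ...   | yes refl | _ = _ , _ , h ∷ a ∷ b ∷ [] , ha ⟶ ac ⟶ stop
                         , (h≢a ∷ All.head h∉ ∷ []) ∷ (All.head a∉ ∷ []) ∷ [] ∷ []
                         , UsesAll-interior [] N
                         , Absorbed⇒UsesAll (atEnd [ h ] a (ha ⟶ ac ⟶ stop) Nb)
    ...   | no w≢a | yes refl with girth h (a ∷ b ∷ []) record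
                { atLeast3 = s≤s (s≤s z≤n)
                ; distinct = (h≢a ∷ All.head h∉ ∷ []) ∷ (All.head a∉ ∷ []) ∷ [] ∷ []
                ; closed = ha ∷ ac ∷ bw ∷ [-] }
    ...     | s≤s (s≤s (s≤s ()))
    throughInterior {h} {a} {b} {c} {p} ha ac N W U@((h≢a ∷ h∉) ∷ a∉ ∷ U₁) d≤2 | yes refl
          | w , bw , Nb | no w≢a | no w≢h =
            _ , _ , h ∷ a ∷ b ∷ w ∷ [] , W′
              , (h≢a ∷ All.head h∉ ∷ (w≢h ∘ sym) ∷ []) ∷ (All.head a∉ ∷ (w≢a ∘ sym) ∷ [])
                  ∷ ((λ { refl → ¬Adj-self H bw }) ∷ []) ∷ [] ∷ []
              , UsesAll-interior [ w ] N
              , Absorbed⇒UsesAll (pastEnd [ h ] a w W′ Nb)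
      where
      W′ : Walk h w (h ∷ a ∷ b ∷ w ∷ [])
      W′ = ha ⟶ ac ⟶ bw ⟶ stop

    -- Absorb `a` at the end of a path from `b`, and reverse. The result starts at `a` with a single
    -- neighbour, or has `a` as second vertex between its neighbours.
    pathThrough : ∀ {a b} → a ≢ b → degree a ≤ 2 → degree b ≤ 2 → Star Adj b a → PathThrough a b
    pathThrough {a} {b} a≢b da db ba with Star⇒Walk ba
    ... | p , W , U with absorb W U (a≢b ∘ sym) da
    ...   | _ , atEnd X q Wr N , Ur , _ =
      throughLeaf (Walk-reverse Wr) (unique-↭ (↭-sym (↭ₚ.↭-reverse _)) Ur) N a≢b db
    ...   | _ , pastEnd X q w Wr N , Ur , _
      with subst (Walk w b) eq (Walk-reverse Wr) | subst Unique eq (unique-↭ (↭-sym (↭ₚ.↭-reverse _)) Ur)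
      where
      eq : reverse (X ++ q ∷ a ∷ w ∷ []) ≡ w ∷ a ∷ q ∷ reverse X
      eq = Listₚ.reverse-++ X (q ∷ a ∷ w ∷ [])
    ...     | e ⟶ (f ⟶ W′) | U′ with refl ← Walk-head W′ = throughInterior e f N′ W′ U′ db
      where
      N′ : NeighboursIn a w q
      N′ u g = [ inj₂ , inj₁ ]′ (N u g)

-- Removing one path at a time

module _ {n : ℕ} (H : Graph n) where
  open Graph H

  degree>0⁺ : ∀ {u v} → Adj u v → 0 < degree u
  degree>0⁺ {u} {v} a = ∈-length (∈-filter⁺ (Adj? u) (∈-allFin v) a)

  degree>0⁻ : ∀ {u} → 0 < degree u → ∃[ v ] Adj u v
  degree>0⁻ {u} d with filter (Adj? u) (allFin n) in eq
  ... | v ∷ _ = v , proj₂ (∈-filter⁻ (Adj? u) {xs = allFin n} (subst (v ∈_) (sym eq) (here refl)))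

  steps-Adj : ∀ {p u v} → Linked Adj p → (u , v) ∈ steps p → Adj u v
  steps-Adj (a ∷ _) (here refl) = a
  steps-Adj (_ ∷ l) (there s)   = steps-Adj l s

  Traverses-Adj : ∀ {p u v} → Linked Adj p → Traverses p u v → Adj u v
  Traverses-Adj l (inj₁ s) = steps-Adj l s
  Traverses-Adj l (inj₂ s) = Adj-sym H (steps-Adj l s)

module _ {n : ℕ} (H : Graph n) where
  open Graph H

  module _ (W : Fin n → Bool) where

    induced : Graph n
    induced = record
      { adj        = λ u v → adj u v ∧ (W u ∧ W v)
      ; adj-sym    = λ u v → cong₂ _∧_ (adj-sym u v) (Boolₚ.∧-comm (W u) (W v))
      ; adj-irrefl = λ v → cong (_∧ (W v ∧ W v)) (adj-irrefl v) }

    induced⁻ : ∀ {u v} → Graph.Adj induced u v → Adj u v × T (W u)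
    induced⁻ a with b , w ← Equivalence.to Boolₚ.T-∧ a = b , proj₁ (Equivalence.to Boolₚ.T-∧ w)

    induced⁺ : ∀ {u v} → Adj u v → T (W u) → T (W v) → Graph.Adj induced u v
    induced⁺ a wu wv = Equivalence.from Boolₚ.T-∧ (a , Equivalence.from Boolₚ.T-∧ (wu , wv))

    degree-induced : (∀ {u v} → Adj u v → T (W u) → T (W v)) → ∀ {v} → T (W v) →
                     degree v ≤ Graph.degree induced v
    degree-induced closed {v} wv = ⊆⇒length≤ (Uniqueₚ.filter⁺ (Adj? v) (Uniqueₚ.allFin⁺ n)) λ x∈ →
      case proj₂ (∈-filter⁻ (Adj? v) {xs = allFin n} x∈) of λ a →
        ∈-filter⁺ (Graph.Adj? induced v) (∈-allFin _) (induced⁺ a wv (closed a wv))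

  edgePairs : List (Fin n × Fin n)
  edgePairs = filter (λ (u , v) → Adj? u v) (cartesianProduct (allFin n) (allFin n))

  component : Fin n → Fin n
  component = label edgePairs

  Adj⇒component : ∀ {u v} → Adj u v → component u ≡ component v
  Adj⇒component a = label-joins edgePairs
    (∈-filter⁺ (λ (u , v) → Adj? u v) (∈-cartesianProduct⁺ (∈-allFin _) (∈-allFin _)) a)

  component⇒Star : ∀ {u v} → component u ≡ component v → Star Adj u v
  component⇒Star {u} {v} eq = Star.reverse (Adj-sym H) (toLabel u) ◅◅ subst (λ z → Star Adj z v) (sym eq) (toLabel v)
    where
    toLabel : ∀ z → Star Adj (component z) z
    toLabel = label-related
      (record { refl = ε ; sym = Star.reverse (Adj-sym H) ; trans = _◅◅_ }) edgePairs
      (λ e∈ → proj₂ (∈-filter⁻ (λ (u , v) → Adj? u v) {xs = cartesianProduct (allFin n) (allFin n)} e∈) ◅ ε)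

  module _ (p : List (Fin n)) where

    step? : ∀ u v → Dec ((u , v) ∈ steps p)
    step? u v = Any.any? (≡-dec _≟_ _≟_ (u , v)) (steps p)

    traverse? : ∀ u v → Dec (Traverses p u v)
    traverse? u v = step? u v ⊎-dec step? v u

    removePath : Graph n
    removePath = record
      { adj        = λ u v → adj u v ∧ not (does (traverse? u v))
      ; adj-sym    = λ u v → cong₂ (λ a b → a ∧ not b) (adj-sym u v) (Boolₚ.∨-comm (does (step? u v)) _)
      ; adj-irrefl = λ v → cong (_∧ not (does (traverse? v v))) (adj-irrefl v) }

    removePath⁺ : ∀ {u v} → Adj u v → ¬ Traverses p u v → Graph.Adj removePath u v
    removePath⁺ {u} {v} a ¬t rewrite dec-false (traverse? u v) ¬t = Equivalence.from Boolₚ.T-∧ (a , tt)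

    removePath⁻ : ∀ {u v} → Graph.Adj removePath u v → Adj u v × ¬ Traverses p u v
    removePath⁻ {u} {v} a with b , c ← Equivalence.to Boolₚ.T-∧ a =
      b , λ t → subst (T ∘ not) (dec-true (traverse? u v) t) c

    prependPath : IsPath H p → ∀ {ps} → IsPathDecomposition removePath ps → IsPathDecomposition H (p ∷ ps)
    prependPath isP {ps} D = record
      { paths    = isP ∷ All.map weaken (IsPathDecomposition.paths D)
      ; disjoint = All.map apart (IsPathDecomposition.paths D) ∷ IsPathDecomposition.disjoint D
      ; covers   = covers }
      where
      weaken : ∀ {q} → IsPath removePath q → IsPath H q
      weaken (isPath ne u l) = isPath ne u (Linked.map (proj₁ ∘ removePath⁻) l)
      apart : ∀ {q} → IsPath removePath q → EdgeDisjoint p q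
      apart (isPath _ _ l) u v t t′ = contradiction t (proj₂ (removePath⁻ (Traverses-Adj removePath l t′)))
      covers : ∀ u v → Adj u v → Any (λ q → Traverses q u v) (p ∷ ps)
      covers u v a with traverse? u v
      ... | yes t = here t
      ... | no ¬t = there (IsPathDecomposition.covers D u v (removePath⁺ a ¬t))

    -- Removing edges makes no isolated vertex active, while `a` and `b` go from active to isolated.
    removePath-nonIsolated : ∀ {a b} → a ≢ b → 0 < degree a → 0 < degree b → UsesAll H p a → UsesAll H p b →
                             2 + Graph.nonIsolated removePath ≤ nonIsolated
    removePath-nonIsolated {a} {b} a≢b da db ua ub =
      ⊆⇒length≤ {xs = a ∷ b ∷ left}
        ((a≢b ∷ All.tabulate (gone ua)) ∷ All.tabulate (gone ub)
          ∷ Uniqueₚ.filter⁺ left? (Uniqueₚ.allFin⁺ n))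
        λ { (here refl) → active da ; (there (here refl)) → active db
          ; (there (there x∈)) → active (degree>0⁺ H (proj₁ (removePath⁻ (proj₂ (neighbour x∈))))) }
      where
      left? : U.Decidable (λ v → 0 < Graph.degree removePath v)
      left? v = 0 <? Graph.degree removePath v
      left : List (Fin n)
      left = filter left? (allFin n)
      active : ∀ {v} → 0 < degree v → v ∈ filter (λ v → 0 <? degree v) (allFin n)
      active d = ∈-filter⁺ (λ v → 0 <? degree v) (∈-allFin _) d
      neighbour : ∀ {v} → v ∈ left → ∃[ u ] Graph.Adj removePath v u
      neighbour v∈ = degree>0⁻ removePath (proj₂ (∈-filter⁻ left? {xs = allFin n} v∈))
      gone : ∀ {v} → UsesAll H p v → ∀ {x} → x ∈ left → v ≢ x
      gone use x∈ refl with u , a ← neighbour x∈ with b , ¬t ← removePath⁻ a = ¬t (use u b)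

-- Low-degree vertices in each component and the induction

module _ {n : ℕ} (G : Graph n) (planar : Planar G) (connected : Graph.Connected G) (girth : GirthAtLeast G 6) where

  module _ (H : Graph n) (H⊆G : _⊆ᴳ_ G H G) where
    open Graph H

    girth-⊆ : GirthAtLeast H 6
    girth-⊆ x xs C = girth x xs record
      { atLeast3 = IsCycle.atLeast3 C ; distinct = IsCycle.distinct C ; closed = Linked.map H⊆G (IsCycle.closed C) }

    module _ (W : Fin n → Bool) (closed : ∀ {u v} → Adj u v → T (W u) → T (W v))
             (positive : ∀ {v} → T (W v) → 0 < degree v) where

      degree-W : ∀ {v} → T (W v) → degree v ≤ Graph.degree (induced H W) v
      degree-W = degree-induced H W closed

      -- Otherwise `a` has degree at least 1 and all other vertices of `W` at least 3. The degree
      -- sum is then at least 3 times the size of `W` minus 2, one more than `sparse` allows.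
      anotherLow : ∀ {a} → T (W a) → ∃[ b ] (b ≢ a × T (W b) × degree b ≤ 2)
      anotherLow {a} a∈ with Finₚ.any? (λ b → ¬? (b ≟ a) ×-dec T? (W b) ×-dec (degree b ≤? 2))
      ... | yes found = found
      ... | no none = contradiction (ℕₚ.≤-trans K-sparse high) (ℕₚ.<⇒≱ (ℕₚ.+-monoʳ-< (degreeSum G K) (ℕₚ.n<1+n 2)))
        where
        open ℕₚ.≤-Reasoning
        K : Graph n
        K = induced H W
        K-sparse : degreeSum G K + 3 ≤ 3 * ∑ (allFin n) (ι ∘ W)
        K-sparse = sparse G planar connected girth K (H⊆G ∘ proj₁ ∘ induced⁻ H W) W a∈ (proj₂ ∘ induced⁻ H W)
        -- The added 2 makes up for `a`, whose degree is only known to be positive.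
        large : ∀ v → T (W v) → 3 ≤ Graph.degree K v + 2 * ι (does (v ≟ a))
        large v v∈ with v ≟ a
        ... | yes refl = ℕₚ.+-monoˡ-≤ 2 (ℕₚ.≤-trans (positive v∈) (degree-W v∈))
        ... | no v≢a = ℕₚ.≤-trans (ℕₚ.≰⇒> (λ low → none (v , v≢a , v∈ , low)))
                         (ℕₚ.≤-trans (degree-W v∈) (ℕₚ.m≤m+n _ 0))
        scale : ∀ w {k} → (T w → 3 ≤ k) → 3 * ι w ≤ k
        scale true  h = h tt
        scale false h = z≤n
        high : 3 * ∑ (allFin n) (ι ∘ W) ≤ degreeSum G K + 2
        high = begin
          3 * ∑ (allFin n) (ι ∘ W)                                          ≡⟨ ∑-*ˡ (allFin n) 3 (ι ∘ W) ⟨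
          ∑ (allFin n) (λ v → 3 * ι (W v))                                  ≤⟨ ∑-mono (allFin n) (λ {v} _ → scale (W v) (large v)) ⟩
          ∑ (allFin n) (λ v → Graph.degree K v + 2 * ι (does (v ≟ a)))      ≡⟨ ∑-+ (allFin n) (Graph.degree K) _ ⟩
          degreeSum G K + ∑ (allFin n) (λ v → 2 * ι (does (v ≟ a)))         ≡⟨ cong (degreeSum G K +_) (∑-*ˡ (allFin n) 2 _) ⟩
          degreeSum G K + 2 * ∑ (allFin n) (λ v → ι (does (v ≟ a)))         ≡⟨ cong (λ k → degreeSum G K + 2 * k) (∑Fin-single a) ⟩
          degreeSum G K + 2                                                 ∎

    reducingPath : ∀ {v₀} → 0 < degree v₀ →
                   ∃[ p ] (IsPath H p × 2 + Graph.nonIsolated (removePath H p) ≤ nonIsolated)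
    -- The vertex `v₀` only selects the component, and its degree may be large. A first low vertex
    -- `a` is found apart from `v₀`, a second one apart from `a`.
    reducingPath {v₀} d₀ = build (low refl)
      where
      inComponent? : U.Decidable (λ v → component H v ≡ component H v₀)
      inComponent? v = component H v ≟ component H v₀
      W : Fin n → Bool
      W v = does (inComponent? v)
      W⁺ : ∀ {v} → component H v ≡ component H v₀ → T (W v)
      W⁺ {v} eq = Equivalence.from Boolₚ.T-≡ (dec-true (inComponent? v) eq)
      W⁻ : ∀ {v} → T (W v) → component H v ≡ component H v₀
      W⁻ {v} w with inComponent? v
      ... | yes eq = eq
      closed : ∀ {u v} → Adj u v → T (W u) → T (W v)
      closed a w = W⁺ (trans (sym (Adj⇒component H a)) (W⁻ w))
      positive : ∀ {v} → component H v ≡ component H v₀ → 0 < degree v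
      positive eq with component⇒Star H eq
      ... | ε     = d₀
      ... | a ◅ _ = degree>0⁺ H a
      Low : Fin n → Fin n → Set
      Low a b = b ≢ a × component H b ≡ component H v₀ × degree b ≤ 2
      low : ∀ {a} → component H a ≡ component H v₀ → ∃[ b ] Low a b
      low a∈ with anotherLow W closed (positive ∘ W⁻) (W⁺ a∈)
      ... | b , b≢a , b∈ , db = b , b≢a , W⁻ b∈ , db
      build : ∃[ a ] Low v₀ a → ∃[ p ] (IsPath H p × 2 + Graph.nonIsolated (removePath H p) ≤ nonIsolated)
      build (a , _ , a∈ , da) with low a∈
      ... | b , b≢a , b∈ , db with pathThrough H girth-⊆ b≢a db da (component⇒Star H (trans a∈ (sym b∈)))
      ... | s , t , p , w , U , ub , ua =
        p , isPath (Walk-length H w) U (Walk⇒Linked H w)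
          , removePath-nonIsolated H p b≢a (positive b∈) (positive a∈) ub ua

  Decomposable : Graph n → Set
  Decomposable H = ∃[ ps ] (IsPathDecomposition H ps × length ps ≤ ⌊ Graph.nonIsolated H /2⌋)

  edgeless : ∀ {H} → ¬ (∃[ v ] 0 < Graph.degree H v) → Decomposable H
  edgeless {H} none = [] , isPathDecomposition [] [] (λ u v a → contradiction (u , degree>0⁺ H a) none) , z≤n

  -- The two vertices lost raise the halved bound by exactly one, which pays for the path.
  prependReducing : ∀ {H p} → IsPath H p → 2 + Graph.nonIsolated (removePath H p) ≤ Graph.nonIsolated H →
                    Decomposable (removePath H p) → Decomposable H
  prependReducing {H} {p} isP drop (ps , D , short) =
    p ∷ ps , prependPath H p isP D , ℕₚ.≤-trans (s≤s short) (ℕₚ.⌊n/2⌋-mono drop)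

  -- Induction on a strict bound `k` for the number of non-isolated vertices. Subgraphs of `G` are
  -- the right generality, since removing a path may destroy connectedness.
  decompose : ∀ k (H : Graph n) → _⊆ᴳ_ G H G → Graph.nonIsolated H < k → Decomposable H
  decompose (suc k) H H⊆G N<k = split (Finₚ.any? (λ v → 0 <? Graph.degree H v))
    where
    split : Dec (∃[ v ] 0 < Graph.degree H v) → Decomposable H
    split (no none)      = edgeless none
    split (yes (_ , d₀)) =
      let p , isP , drop = reducingPath H H⊆G d₀
      in prependReducing isP drop (decompose k (removePath H p) (H⊆G ∘ proj₁ ∘ removePath⁻ H p)
           (ℕₚ.≤-trans (ℕₚ.≤-trans (ℕₚ.n≤1+n _) drop) (ℕₚ.≤-pred N<k)))

theorem2p2 : (n : ℕ) (G : Graph n) → Graph.Connected G → Planar G → GirthAtLeast G 6 → Gallai G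
theorem2p2 n G connected planar girth =
  let ps , D , short = decompose G planar connected girth _ G id ℕₚ.≤-refl
  in ℕₚ.≤-trans (pn-minimal G ps D) short
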